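{- Let $n,k$ be positive integers with $2k<n\le 3k$ (so $p=\lceil n/k\rceil=3$). Then: (a) $\mathrm{op}(n,k)=\mathrm{opt}(n,k)=\mathrm{constr}(n,k)$. (b) For every (not necessarily optimal) $(n,k)$-generator $\mathcal G$, $|\mathcal G^i|\ge \mathrm{constr}^i(n,k)$ for $i=1,2,3$. (c) For every (not necessarily optimal) $(n,k)$-generator $\mathcal G$, there exists $z\in[n]$ such that $|\{g\in\mathcal G: z\in g\}|\ge 2^{p-1}=4$. (d) $\mathrm{Constr}(n,k)$ is the unique optimal $(n,k)$-generator, i.e. every optimal $(n,k)$-generator is of the form $\mathrm{Constr}(n,k)$ for some choice of the underlying partition.
   Context: $[n]=\{1,\dots,n\}$. For positive integers $n,k$, an $(n,k)$-generator is a family $\mathcal G$ of subsets of $[n]$ such that every non-empty subset of $[n]$ is a disjoint union of at most $k$ members of $\mathcal G$. $\mathrm{opt}(n,k)$ is the minimum of $|\mathcal G|$ over all $(n,k)$-generators, and a generator is optimal if it attains this minimum. $\mathrm{op}(n,k)$ is the minimum size of a family $\mathcal G$ of subsets of $[n]$ such that every non-empty subset of $[n]$ is a (not necessarily disjoint) union of at most $k$ members of $\mathcal G$. Let $p=\lceil n/k\rceil$ and $n=pk-r$ with $0\le r<k$. Let $V_1,\dots,V_k$ be an arbitrary partition of $[n]$ into $r$ sets of size $p-1$ and $k-r$ sets of size $p$. Then $\mathrm{Constr}(n,k):=(\mathcal P(V_1)\cup\dots\cup\mathcal P(V_k))\setminus\{\emptyset\}$ (well defined up to the choice of partition) and $\mathrm{constr}(n,k):=|\mathrm{Constr}(n,k)|=r(2^{p-1}-1)+(k-r)(2^p-1)$.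 For a family $\mathcal G$ of subsets of $[n]$, $\mathcal G^i:=\{g\in\mathcal G:|g|\ge i\}$, and $\mathrm{constr}^i(n,k):=|\{g\in \mathrm{Constr}(n,k): |g|\ge i\}|$. -}

module Defs where

open import Data.Fin.Base using (Fin)
open import Data.Fin.Properties using (any?)
open import Data.Fin.Subset
  using (Subset; inside; outside; _∈_; _⊆_; _∩_; ⋃; ∣_∣; Nonempty; Empty)
open import Data.Fin.Subset.Properties using (_∈?_; _⊆?_; nonempty?)
open import Data.List.Base using (List; []; _∷_; _++_; map; filter; length; allFin)
import Data.List.Membership.Propositional as List
open import Data.List.Membership.Propositional.Properties using (∈-map⁻)
open import Data.List.Relation.Binary.BagAndSetEquality using (_∼[_]_; set)
import Data.List.Relation.Binary.Subset.Propositional as List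
open import Data.List.Relation.Unary.All using ([])
open import Data.List.Relation.Unary.AllPairs using (AllPairs; []; _∷_)
open import Data.List.Relation.Unary.Unique.Propositional using (Unique)
import Data.List.Relation.Unary.Unique.Propositional.Properties as Unique
open import Data.Nat.Base
  using (ℕ; zero; suc; _+_; _*_; _∸_; _^_; _/_; _≤_; NonZero)
open import Data.Nat.Properties using (_≟_; _≤?_)
open import Data.Product.Base using (∃-syntax; _×_; _,_)
import Data.Vec.Base as Vec
open import Data.Vec.Properties using (∷-injectiveˡ; ∷-injectiveʳ)
open import Relation.Binary.PropositionalEquality using (_≡_; _≢_; trans; sym)
open import Relation.Nullary using (¬_)
open import Relation.Nullary.Decidable using (_×-dec_)
open import Relation.Unary using (Decidable)

private
  variable
    n k : ℕ

-- The ground set is Fin n.  Since members are listed without repetition,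
-- the cardinality of a family is the length of the list; the order of the
-- list is irrelevant, so families are compared with _≈_ rather than _≡_.

record Family (n : ℕ) : Set where
  constructor family
  field
    members : List (Subset n)
    unique  : Unique members

open Family public

infix 4 _≈_ _⊑_

_≈_ : Family n → Family n → Set
𝒢 ≈ ℋ = members 𝒢 ∼[ set ] members ℋ

_⊑_ : Family n → Family n → Set
ℋ ⊑ 𝒢 = members ℋ List.⊆ members 𝒢

size : Family n → ℕ
size 𝒢 = length (members 𝒢)

restrict : {P : Subset n → Set} → Decidable P → Family n → Family n
restrict P? (family gs u) = family (filter P? gs) (Unique.filter⁺ P? u)

subsets : ∀ n → List (Subset n)
subsets zero    = Vec.[] ∷ []
subsets (suc n) = map (outside Vec.∷_) (subsets n) ++ map (inside Vec.∷_) (subsets n)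

subsets-unique : ∀ n → Unique (subsets n)
subsets-unique zero    = [] ∷ []
subsets-unique (suc n) = Unique.++⁺
  (Unique.map⁺ ∷-injectiveʳ (subsets-unique n))
  (Unique.map⁺ ∷-injectiveʳ (subsets-unique n))
  disjoint
  where
  disjoint : ∀ {s} → ¬ (s List.∈ map (outside Vec.∷_) (subsets n) ×
                        s List.∈ map (inside Vec.∷_) (subsets n))
  disjoint (p , q) with ∈-map⁻ _ p | ∈-map⁻ _ q
  ... | _ , _ , e | _ , _ , e′ with () ← ∷-injectiveˡ (trans (sym e) e′)

powerset : ∀ n → Family n
powerset n = family (subsets n) (subsets-unique n)

infix 9 _≥∣_∣

-- 𝒢 ≥∣ i ∣ is 𝒢ⁱ = {g ∈ 𝒢 : |g| ≥ i}.
_≥∣_∣ : Family n → ℕ → Family n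
𝒢 ≥∣ i ∣ = restrict (λ g → i ≤? ∣ g ∣) 𝒢

degree : Fin n → Family n → ℕ
degree z 𝒢 = size (restrict (z ∈?_) 𝒢)

Disjoint : Subset n → Subset n → Set
Disjoint s t = Empty (s ∩ t)

IsUnion : ℕ → Family n → Subset n → Set
IsUnion k 𝒢 s = ∃[ ℋ ] ℋ ⊑ 𝒢 × size ℋ ≤ k × ⋃ (members ℋ) ≡ s

IsDisjointUnion : ℕ → Family n → Subset n → Set
IsDisjointUnion k 𝒢 s =
  ∃[ ℋ ] ℋ ⊑ 𝒢 × size ℋ ≤ k × AllPairs Disjoint (members ℋ) × ⋃ (members ℋ) ≡ s

-- The notion minimised by op(n,k): unions need not be disjoint.
WeakGenerator : ∀ n → ℕ → Family n → Set
WeakGenerator n k 𝒢 = ∀ s → Nonempty s → IsUnion k 𝒢 s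

Generator : ∀ n → ℕ → Family n → Set
Generator n k 𝒢 = ∀ s → Nonempty s → IsDisjointUnion k 𝒢 s

IsMinimumSize : (Family n → Set) → ℕ → Set
IsMinimumSize P m = (∃[ 𝒢 ] P 𝒢 × size 𝒢 ≡ m) × (∀ 𝒢 → P 𝒢 → m ≤ size 𝒢)

-- "op(n,k) = m" and "opt(n,k) = m"; a minimum is unique by antisymmetry of _≤_.
IsOp : ℕ → ℕ → ℕ → Set
IsOp n k = IsMinimumSize (WeakGenerator n k)

IsOpt : ℕ → ℕ → ℕ → Set
IsOpt n k = IsMinimumSize (Generator n k)

Optimal : ∀ n → ℕ → Family n → Set
Optimal n k 𝒢 = Generator n k 𝒢 × IsOpt n k (size 𝒢)

⌈_/_⌉ : (n k : ℕ) .{{_ : NonZero k}} → ℕ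
⌈ n / k ⌉ = (n + (k ∸ 1)) / k

-- The r of n = pk - r, where p = ⌈ n / k ⌉.
deficit : (n k : ℕ) .{{_ : NonZero k}} → ℕ
deficit n k = ⌈ n / k ⌉ * k ∸ n

partsOfSize : ℕ → (Fin k → Subset n) → ℕ
partsOfSize {k = k} m V = length (filter (λ i → ∣ V i ∣ ≟ m) (allFin k))

-- As there are k parts altogether and p - 1 ≢ p for positive n, the two
-- counts leave no parts of any other size.  Parts may be empty (when p = 1).
record BalancedPartition (n k : ℕ) .{{_ : NonZero k}} : Set where
  field
    part     : Fin k → Subset n
    disjoint : ∀ {i j} → i ≢ j → Disjoint (part i) (part j)
    covering : ∀ x → ∃[ i ] x ∈ part i
    small    : partsOfSize (⌈ n / k ⌉ ∸ 1) part ≡ deficit n k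
    large    : partsOfSize ⌈ n / k ⌉ part ≡ k ∸ deficit n k

open BalancedPartition public

Constr : ∀ n k .{{_ : NonZero k}} → BalancedPartition n k → Family n
Constr n k π =
  restrict (λ s → any? (λ i → s ⊆? part π i) ×-dec nonempty? s) (powerset n)

-- The cardinality of Constr n k π, for any π.
constr : (n k : ℕ) .{{_ : NonZero k}} → ℕ
constr n k = r * (2 ^ (p ∸ 1) ∸ 1) + (k ∸ r) * (2 ^ p ∸ 1)
  where
  p = ⌈ n / k ⌉
  r = deficit n k

{-# OPTIONS --safe #-}
-- Call the members of 𝒢 of size at least 2 edges.  All singletons lie in 𝒢, and if a set X has a
-- vertex v in no edge inside X, then X - v needs one member fewer than X to cover its subsets.
--
-- Main step: if |X| > 2k and every subset of X is a union of at most k members, then some vertex lies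
-- in three edges inside X.  Otherwise every vertex lies in at most two.  Some edge has at least three
-- vertices; follow edges and shared vertices from it until an edge recurs.  The cycle obtained carries
-- a spare vertex at its closing edge, so deleting every other vertex of the cycle (and the spare one if
-- the cycle is odd) puts the remaining ones in no edge.  This removes at most 2s vertices while k drops
-- by s, and induction applies.
--
-- Deleting vertices of degree three down to |X| = 2k yields at least 3n - 5k edges, the number in
-- Constr(n,k); hitting all triples gives at least n - 2k of them.  In the extremal case the last stage
-- is a perfect matching, and each vertex put back lies in exactly three edges.  Disjointness of the
-- covers of X and of X minus a few points forces these to be za, zb, zab for a part ab.

module Submission where

open import Defs
import Data.Bool.Properties as Bool
open import Data.Empty using (⊥-elim)
open import Data.Fin.Base using (Fin; zero; suc; toℕ; fromℕ<)
import Data.Fin.Properties as Fin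
open import Data.Fin.Subset
  using (Subset; inside; outside; _∈_; _∉_; _⊆_; _∩_; _∪_; _-_; ⋃; ∣_∣; ⁅_⁆; ⊤; Nonempty)
open import Data.Fin.Subset.Properties
open import Data.List.Base
  using (List; []; _∷_; _++_; map; filter; length; lookup; allFin; concatMap; tabulate)
import Data.List.Membership.Propositional as List
open import Data.List.Membership.Propositional.Properties
  using ( ∈-∃++; ∈-++⁺ˡ; ∈-++⁺ʳ; ∈-++⁻; ∈-filter⁺; ∈-filter⁻; ∈-map⁺; ∈-map⁻; ∈-lookup; ∈-allFin
        ; ∈-tabulate⁺; ∈-tabulate⁻; ∈-concatMap⁺ )
open import Data.List.Properties
  using ( length-++; length-++-sucʳ; length-map; length-tabulate; length-filter; filter-notAll
        ; filter-accept; filter-reject; map-tabulate; map-cong )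
import Data.List.Relation.Binary.Subset.Propositional as List
open import Data.List.Relation.Unary.All as All using (All; []; _∷_)
open import Data.List.Relation.Unary.AllPairs using (AllPairs; []; _∷_)
import Data.List.Relation.Unary.AllPairs.Properties as AllPairs
open import Data.List.Relation.Unary.Any as Any using (Any; here; there)
import Data.List.Relation.Unary.Any.Properties as Any
open import Data.List.Relation.Unary.Unique.Propositional using (Unique)
import Data.List.Relation.Unary.Unique.Propositional.Properties as Unique
import Data.Nat.Base as ℕ
open import Data.Nat.Base
  using (ℕ; zero; suc; _+_; _*_; _∸_; _^_; _/_; _%_; _≤_; _<_; _≥_; NonZero; z≤n; s≤s)
open import Data.Nat.DivMod
  using (_mod_; m≡m%n+[m/n]*n; m<n⇒m%n≡m; [m+kn]%n≡m%n; m%n<n; /-monoˡ-≤; m*n/n≡m; m<n*o⇒m/o<n)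
open import Data.Nat.Induction using (<-wellFounded; Acc; acc)
open import Data.Nat.ListAction using (sum)
open import Data.Nat.Properties
open import Data.Nat.Tactic.RingSolver using (solve-∀)
open import Data.Product.Base using (∃-syntax; Σ-syntax; _×_; _,_; proj₁; proj₂)
open import Data.Sum.Base using (_⊎_; inj₁; inj₂)
import Data.Vec.Base as Vec
open import Data.Vec.Base using ([]; _∷_; here; there)
import Data.Vec.Properties as Vec
open import Function.Base using (_∘_; id)
open import Function.Bundles using (mk⇔)
open import Relation.Binary.PropositionalEquality
open import Relation.Nullary using (¬_; yes; no; contradiction)
open import Relation.Nullary.Decidable using (Dec; _×-dec_; ¬?; does; dec-true)
open import Relation.Unary using (Decidable)

private
  variable
    n k : ℕ
    A : Set

-- Lists and finite subsets

remove-mid : ∀ {x y : A} (xs : List A) {ys} → y ≢ x → y List.∈ xs ++ x ∷ ys → y List.∈ xs ++ ys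
remove-mid []       y≢x (here e)  = ⊥-elim (y≢x e)
remove-mid []       y≢x (there p) = p
remove-mid (_ ∷ xs) y≢x (here e)  = here e
remove-mid (_ ∷ xs) y≢x (there p) = there (remove-mid xs y≢x p)

unique-⊆⇒length≤ : ∀ {xs ys : List A} → Unique xs → xs List.⊆ ys → length xs ≤ length ys
unique-⊆⇒length≤ [] _ = z≤n
unique-⊆⇒length≤ {xs = x ∷ xs} (x∉ ∷ u) sub with ∈-∃++ (sub (here refl))
... | ys , zs , refl = subst (suc (length xs) ≤_) (sym (length-++-sucʳ ys x zs))
  (s≤s (unique-⊆⇒length≤ u λ y∈ → remove-mid ys (λ e → All.lookup x∉ y∈ (sym e)) (sub (there y∈))))

AllPairs-lookup : ∀ {R : A → A → Set} → (∀ {x y} → R x y → R y x) → ∀ {xs} → AllPairs R xs →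
                  ∀ {x y} → x List.∈ xs → y List.∈ xs → x ≢ y → R x y
AllPairs-lookup sy (r ∷ rs) (here refl) (here refl) x≢y = ⊥-elim (x≢y refl)
AllPairs-lookup sy (r ∷ rs) (here refl) (there q)   x≢y = All.lookup r q
AllPairs-lookup sy (r ∷ rs) (there p)   (here refl) x≢y = sy (All.lookup r p)
AllPairs-lookup sy (r ∷ rs) (there p)   (there q)   x≢y = AllPairs-lookup sy rs p q x≢y

disjoint-sym : ∀ {s t : Subset n} → Disjoint s t → Disjoint t s
disjoint-sym {s = s} {t} d (x , p) = let (a , b) = x∈p∩q⁻ t s p in d (x , x∈p∩q⁺ (b , a))

disjoint-∉ : ∀ {s t : Subset n} {x} → Disjoint s t → x ∈ s → x ∉ t
disjoint-∉ d p q = d (_ , x∈p∩q⁺ (p , q))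

∈-⋃⁺ : ∀ {gs : List (Subset n)} {g x} → g List.∈ gs → x ∈ g → x ∈ ⋃ gs
∈-⋃⁺ {gs = g ∷ gs} (here refl) x∈ = p⊆p∪q (⋃ gs) x∈
∈-⋃⁺ {gs = g ∷ gs} (there p)   x∈ = q⊆p∪q g (⋃ gs) (∈-⋃⁺ p x∈)

∈-⋃⁻ : ∀ (gs : List (Subset n)) {x} → x ∈ ⋃ gs → ∃[ g ] g List.∈ gs × x ∈ g
∈-⋃⁻ []       x∈ = ⊥-elim (∉⊥ x∈)
∈-⋃⁻ (g ∷ gs) x∈ with x∈p∪q⁻ g (⋃ gs) x∈
... | inj₁ p = g , here refl , p
... | inj₂ p = let (h , q , r) = ∈-⋃⁻ gs p in h , there q , r

∣p∪q∣≤∣p∣+∣q∣ : ∀ (p q : Subset n) → ∣ p ∪ q ∣ ≤ ∣ p ∣ + ∣ q ∣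
∣p∪q∣≤∣p∣+∣q∣ [] [] = z≤n
∣p∪q∣≤∣p∣+∣q∣ (outside ∷ p) (outside ∷ q) = ∣p∪q∣≤∣p∣+∣q∣ p q
∣p∪q∣≤∣p∣+∣q∣ (inside  ∷ p) (outside ∷ q) = s≤s (∣p∪q∣≤∣p∣+∣q∣ p q)
∣p∪q∣≤∣p∣+∣q∣ (outside ∷ p) (inside  ∷ q) =
  subst (suc ∣ p ∪ q ∣ ≤_) (sym (+-suc ∣ p ∣ ∣ q ∣)) (s≤s (∣p∪q∣≤∣p∣+∣q∣ p q))
∣p∪q∣≤∣p∣+∣q∣ (inside  ∷ p) (inside  ∷ q) =
  s≤s (≤-trans (∣p∪q∣≤∣p∣+∣q∣ p q) (+-monoʳ-≤ ∣ p ∣ (n≤1+n _)))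

∣⋃∣≤sum : ∀ (gs : List (Subset n)) → ∣ ⋃ gs ∣ ≤ sum (map ∣_∣ gs)
∣⋃∣≤sum {n} []  = ≤-reflexive (∣⊥∣≡0 n)
∣⋃∣≤sum (g ∷ gs) = ≤-trans (∣p∪q∣≤∣p∣+∣q∣ g (⋃ gs)) (+-monoʳ-≤ ∣ g ∣ (∣⋃∣≤sum gs))

x∉p-x : ∀ (p : Subset n) x → x ∉ p - x
x∉p-x (_ ∷ p) zero    ()
x∉p-x (_ ∷ p) (suc x) (there q) = x∉p-x p x q

p-x⊆p : ∀ (p : Subset n) x → p - x ⊆ p
p-x⊆p p x = p─q⊆p p ⁅ x ⁆

∣p∣≤1+∣p-x∣ : ∀ (p : Subset n) x → ∣ p ∣ ≤ suc ∣ p - x ∣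
∣p∣≤1+∣p-x∣ (inside  ∷ p) zero = s≤s (≤-reflexive (cong ∣_∣ (sym (p─⊥≡p p))))
∣p∣≤1+∣p-x∣ (outside ∷ p) zero = ≤-trans (n≤1+n _) (s≤s (≤-reflexive (cong ∣_∣ (sym (p─⊥≡p p)))))
∣p∣≤1+∣p-x∣ (inside  ∷ p) (suc x) = s≤s (∣p∣≤1+∣p-x∣ p x)
∣p∣≤1+∣p-x∣ (outside ∷ p) (suc x) = ∣p∣≤1+∣p-x∣ p x

∣p-x∣+1 : ∀ {p : Subset n} {x} → x ∈ p → ∣ p ∣ ≡ suc ∣ p - x ∣
∣p-x∣+1 {p = p} x∈ = ≤-antisym (∣p∣≤1+∣p-x∣ p _) (x∈p⇒∣p-x∣<∣p∣ x∈)

0<∣p∣⇒nonempty : ∀ (p : Subset n) → 0 < ∣ p ∣ → Nonempty p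
0<∣p∣⇒nonempty {n} p h with nonempty? p
... | yes e = e
... | no ¬e = ⊥-elim (<-irrefl (sym (trans (cong ∣_∣ (Empty-unique ¬e)) (∣⊥∣≡0 n))) h)

nonempty⇒0<∣p∣ : ∀ {p : Subset n} {x} → x ∈ p → 0 < ∣ p ∣
nonempty⇒0<∣p∣ {p = p} x∈ = subst (1 ≤_) (sym (∣p-x∣+1 x∈)) (s≤s z≤n)

two-elements⇒2≤ : ∀ {p : Subset n} {x y} → x ∈ p → y ∈ p → x ≢ y → 2 ≤ ∣ p ∣
two-elements⇒2≤ x∈ y∈ x≢y =
  subst (2 ≤_) (sym (∣p-x∣+1 x∈)) (s≤s (nonempty⇒0<∣p∣ (x∈p∧x≢y⇒x∈p-y y∈ (x≢y ∘ sym))))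

-- The deleted points form a list, which may repeat or leave `p`: its length still bounds the loss
-- of elements from above.
_∖_ : Subset n → List (Fin n) → Subset n
p ∖ []       = p
p ∖ (x ∷ xs) = (p - x) ∖ xs

∖-⊆ : ∀ {p : Subset n} xs → p ∖ xs ⊆ p
∖-⊆ []       q = q
∖-⊆ {p = p} (x ∷ xs) q = p-x⊆p p x (∖-⊆ xs q)

∈-∖⁻ : ∀ {p : Subset n} xs {x} → x ∈ p ∖ xs → ¬ x List.∈ xs
∈-∖⁻ (y ∷ xs) q (here refl) = x∉p-x _ _ (∖-⊆ xs q)
∈-∖⁻ (y ∷ xs) q (there r)   = ∈-∖⁻ xs q r

∈-∖⁺ : ∀ {p : Subset n} xs {x} → x ∈ p → ¬ x List.∈ xs → x ∈ p ∖ xs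
∈-∖⁺ [] q r = q
∈-∖⁺ (y ∷ xs) q r = ∈-∖⁺ xs (x∈p∧x≢y⇒x∈p-y q (r ∘ here)) (r ∘ there)

∣p∣≤∣p∖xs∣+length : ∀ (p : Subset n) xs → ∣ p ∣ ≤ ∣ p ∖ xs ∣ + length xs
∣p∣≤∣p∖xs∣+length p [] = m≤m+n _ 0
∣p∣≤∣p∖xs∣+length p (x ∷ xs) = begin
  ∣ p ∣                               ≤⟨ ∣p∣≤1+∣p-x∣ p x ⟩
  suc ∣ p - x ∣                       ≤⟨ s≤s (∣p∣≤∣p∖xs∣+length (p - x) xs) ⟩
  suc (∣ (p - x) ∖ xs ∣ + length xs)  ≡⟨ +-suc _ _ ⟨
  ∣ (p - x) ∖ xs ∣ + length (x ∷ xs)  ∎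
  where open ≤-Reasoning

abstract
  larger⇒∃ : ∀ (p : Subset n) xs → length xs < ∣ p ∣ → ∃[ x ] x ∈ p × ¬ x List.∈ xs
  larger⇒∃ p xs lt =
    let (x , x∈) = 0<∣p∣⇒nonempty (p ∖ xs)
                     (+-cancelʳ-≤ (length xs) 1 _ (≤-trans lt (∣p∣≤∣p∖xs∣+length p xs)))
    in x , ∖-⊆ xs x∈ , ∈-∖⁻ xs x∈

length≤∣p∣ : ∀ (p : Subset n) xs → Unique xs → (∀ {x} → x List.∈ xs → x ∈ p) → length xs ≤ ∣ p ∣
length≤∣p∣ p [] _ _ = z≤n
length≤∣p∣ p (x ∷ xs) (x∉ ∷ u) sub = subst (suc (length xs) ≤_) (sym (∣p-x∣+1 (sub (here refl))))
  (s≤s (length≤∣p∣ (p - x) xs u λ y∈ → x∈p∧x≢y⇒x∈p-y (sub (there y∈)) (λ e → All.lookup x∉ y∈ (sym e))))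

∣p∣≤length : ∀ (p : Subset n) xs → (∀ {x} → x ∈ p → x List.∈ xs) → ∣ p ∣ ≤ length xs
∣p∣≤length p xs sub with length xs <? ∣ p ∣
... | no  ≮ = ≮⇒≥ ≮
... | yes lt = let (_ , x∈ , x∉) = larger⇒∃ p xs lt in ⊥-elim (x∉ (sub x∈))

_≟ˢ_ : ∀ (f h : Subset n) → Dec (f ≡ h)
_≟ˢ_ = Vec.≡-dec Bool._≟_

-- Covers and the deletion of isolated vertices

-- `within` and `onto` are the two inclusions of the equation "the union of `parts` is `S`".
-- Repetitions in `parts` are allowed, so members can be filtered and counted freely.
record Cover (G : List (Subset n)) (k : ℕ) (S : Subset n) : Set where
  field
    parts  : List (Subset n)
    from   : parts List.⊆ G
    few    : length parts ≤ k
    within : ∀ {h} → h List.∈ parts → h ⊆ S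
    onto   : ∀ {x} → x ∈ S → ∃[ h ] h List.∈ parts × x ∈ h

open Cover

-- In all inductions `G` stays fixed while `X` shrinks: a cover of a subset of `X` uses only members
-- lying inside `X`.
Coverable : List (Subset n) → Subset n → ℕ → Set
Coverable G X k = ∀ S → S ⊆ X → Cover G k S

coverable-⊆ : ∀ {G : List (Subset n)} {X Y} → Y ⊆ X → Coverable G X k → Coverable G Y k
coverable-⊆ Y⊆X C S S⊆Y = C S (λ q → Y⊆X (S⊆Y q))

cover-size : ∀ (gs : List (Subset n)) {S} s → (∀ {h} → h List.∈ gs → ∣ h ∣ ≤ s) →
             (∀ {x} → x ∈ S → ∃[ h ] h List.∈ gs × x ∈ h) → ∣ S ∣ ≤ length gs * s
cover-size gs s small onto =
  ≤-trans (p⊆q⇒∣p∣≤∣q∣ λ x∈ → let (_ , h∈ , x∈h) = onto x∈ in ∈-⋃⁺ h∈ x∈h)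
    (≤-trans (∣⋃∣≤sum gs) (sum≤ gs small))
  where
  sum≤ : ∀ gs → (∀ {h} → h List.∈ gs → ∣ h ∣ ≤ s) → sum (map ∣_∣ gs) ≤ length gs * s
  sum≤ []       _ = z≤n
  sum≤ (g ∷ gs) f = +-mono-≤ (f (here refl)) (sum≤ gs (f ∘ there))

-- Cover `X` minus `ds` by at most `k` members. They avoid `ds`, so none has more than `s` elements,
-- and together they contain at most `k * s` points.
hitting-bound : ∀ {G : List (Subset n)} {X} s ds → Coverable G X k →
  (∀ {g} → g List.∈ G → g ⊆ X → s < ∣ g ∣ → ∃[ d ] d List.∈ ds × d ∈ g) →
  ∣ X ∣ ≤ length ds + k * s
hitting-bound {k = k} {X = X} s ds C hit = begin
  ∣ X ∣                          ≤⟨ ∣p∣≤∣p∖xs∣+length X ds ⟩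
  ∣ X ∖ ds ∣ + length ds         ≤⟨ +-monoˡ-≤ _ (cover-size (parts c) s light (onto c)) ⟩
  length (parts c) * s + length ds ≤⟨ +-monoˡ-≤ _ (*-monoˡ-≤ s (few c)) ⟩
  k * s + length ds              ≡⟨ +-comm (k * s) _ ⟩
  length ds + k * s              ∎
  where
  open ≤-Reasoning
  c = C (X ∖ ds) (∖-⊆ ds)
  light : ∀ {h} → h List.∈ parts c → ∣ h ∣ ≤ s
  light {h} h∈ with s <? ∣ h ∣
  ... | no  ≮ = ≮⇒≥ ≮
  ... | yes lt = let (d , d∈ , d∈h) = hit (from c h∈) (λ q → ∖-⊆ ds (within c h∈ q)) lt in
                 ⊥-elim (∈-∖⁻ ds (within c h∈ d∈h) d∈)

Any⇒0<length : ∀ {P : A → Set} {xs} → Any P xs → 0 < length xs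
Any⇒0<length (here _)  = s≤s z≤n
Any⇒0<length (there _) = s≤s z≤n

-- A vertex that only its singleton covers uses up one member of every cover.
delete-isolated : ∀ {G : List (Subset n)} {X v} → v ∈ X → Coverable G X k →
  (∀ {g} → g List.∈ G → g ⊆ X → v ∈ g → ¬ 2 ≤ ∣ g ∣) →
  ∃[ k′ ] k ≡ suc k′ × Coverable G (X - v) k′
delete-isolated {k = zero} {X = X} v∈X C _ =
  ⊥-elim (n≮0 (<-≤-trans (Any⇒0<length (proj₁ (proj₂ (onto (C X id) v∈X)))) (few (C X id))))
delete-isolated {k = suc k} {G = G} {X} {v} v∈X C isolated = k , refl , shrink
  where
  shrink : Coverable G (X - v) k
  shrink S S⊆ = record
    -- A cover of `S` together with `v` becomes one of `S` when the members containing `v` are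
    -- dropped. At least one is dropped, and none of them contains a point of `S`.
    { parts  = filter P? (parts c)
    ; from   = λ h∈ → from c (proj₁ (∈-filter⁻ P? h∈))
    ; few    = ℕ.s≤s⁻¹ (≤-trans (filter-notAll P? (parts c) (Any.map (λ { refl v∉ → v∉ v∈h₀ }) h₀∈)) (few c))
    ; within = λ h∈ → let (p , v∉h) = ∈-filter⁻ P? h∈ in λ x∈h → strip (within c p x∈h) (λ { refl → v∉h x∈h })
    ; onto   = λ x∈S → let (h , h∈ , x∈h) = onto c (p⊆p∪q ⁅ v ⁆ x∈S) in
        h , ∈-filter⁺ P? h∈ (λ v∈h → isolated (from c h∈) (λ q → S∪v⊆X (within c h∈ q)) v∈h
              (two-elements⇒2≤ v∈h x∈h λ { refl → x∉p-x X v (S⊆ x∈S) })) , x∈h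
    }
    where
    P? : Decidable (v ∉_)
    P? h = ¬? (v ∈? h)
    S∪v⊆X : S ∪ ⁅ v ⁆ ⊆ X
    S∪v⊆X q with x∈p∪q⁻ S ⁅ v ⁆ q
    ... | inj₁ q = p-x⊆p X v (S⊆ q)
    ... | inj₂ q rewrite x∈⁅y⁆⇒x≡y v q = v∈X
    strip : ∀ {x} → x ∈ S ∪ ⁅ v ⁆ → x ≢ v → x ∈ S
    strip q x≢v with x∈p∪q⁻ S ⁅ v ⁆ q
    ... | inj₁ q = q
    ... | inj₂ q = ⊥-elim (x≢v (x∈⁅y⁆⇒x≡y v q))
    c = C (S ∪ ⁅ v ⁆) S∪v⊆X
    h₀∈ = proj₁ (proj₂ (onto c (q⊆p∪q S ⁅ v ⁆ (x∈⁅x⁆ v))))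
    v∈h₀ = proj₂ (proj₂ (onto c (q⊆p∪q S ⁅ v ⁆ (x∈⁅x⁆ v))))

delete-isolated* : ∀ {G : List (Subset n)} {X} vs → Unique vs → (∀ {v} → v List.∈ vs → v ∈ X) →
  Coverable G X k →
  (∀ {v g} → v List.∈ vs → g List.∈ G → g ⊆ X → v ∈ g → ¬ 2 ≤ ∣ g ∣) →
  ∃[ k′ ] k ≡ length vs + k′ × Coverable G (X ∖ vs) k′
delete-isolated* {k = k} [] _ _ C _ = k , refl , C
delete-isolated* {X = X} (v ∷ vs) (v∉ ∷ u) vs⊆X C isolated
  with delete-isolated (vs⊆X (here refl)) C (isolated (here refl))
... | k₁ , refl , C₁
  with delete-isolated* vs u
         (λ w∈ → x∈p∧x≢y⇒x∈p-y (vs⊆X (there w∈)) (λ e → All.lookup v∉ w∈ (sym e))) C₁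
         (λ w∈ g∈ g⊆ → isolated (there w∈) g∈ (λ q → p-x⊆p X v (g⊆ q)))
... | k₂ , refl , C₂ = k₂ , refl , C₂

-- Edges, walks and cycles

Edge : List (Subset n) → Subset n → Subset n → Set
Edge G X g = g List.∈ G × g ⊆ X × 2 ≤ ∣ g ∣

-- The candidates `g` and `h` may coincide and need not be edges, so degrees 0, 1 and 2 are treated
-- alike.
AtMostTwo : List (Subset n) → Subset n → Fin n → Set
AtMostTwo G X v = ∃[ g ] ∃[ h ] ∀ {f} → Edge G X f → v ∈ f → f ≡ g ⊎ f ≡ h

-- Positions count from 0, so the head belongs to `evens`. On a cycle, one of the two classes is
-- deleted in order to isolate the other.
evens odds : List A → List A
evens []       = []
evens (x ∷ xs) = x ∷ odds xs
odds []        = []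
odds (x ∷ xs)  = evens xs

evens-⊆ : ∀ (xs : List A) → evens xs List.⊆ xs
odds-⊆  : ∀ (xs : List A) → odds xs List.⊆ xs
evens-⊆ (x ∷ xs) (here e)  = here e
evens-⊆ (x ∷ xs) (there p) = there (odds-⊆ xs p)
odds-⊆ (x ∷ xs) p = there (evens-⊆ xs p)

evens-unique : ∀ {xs : List A} → Unique xs → Unique (evens xs)
odds-unique  : ∀ {xs : List A} → Unique xs → Unique (odds xs)
evens-unique [] = []
evens-unique {xs = _ ∷ xs} (x∉ ∷ u) = All.tabulate (λ p → All.lookup x∉ (odds-⊆ xs p)) ∷ odds-unique u
odds-unique [] = []
odds-unique (_ ∷ u) = evens-unique u

evens-odds-disjoint : ∀ {xs : List A} → Unique xs → ∀ {x} → x List.∈ evens xs → ¬ x List.∈ odds xs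
evens-odds-disjoint {xs = _ ∷ xs} (x∉ ∷ u) (here refl) q = All.lookup x∉ (evens-⊆ xs q) refl
evens-odds-disjoint {xs = _ ∷ xs} (_ ∷ u)  (there p)   q = evens-odds-disjoint u q p

-- Two distinct edges through `v` exhaust the two candidates. This yields the condition under which
-- `v` may link two nodes of a walk.
exactly-two : ∀ {G : List (Subset n)} {X v f h} → AtMostTwo G X v → Edge G X h → v ∈ h →
  Edge G X f → v ∈ f → f ≢ h → ∀ {g} → Edge G X g → v ∈ g → g ≡ f ⊎ g ≡ h
exactly-two (a , b , t) E v∈h F v∈f f≢h D v∈g with t E v∈h | t F v∈f | t D v∈g
... | inj₁ refl | inj₁ refl | _         = ⊥-elim (f≢h refl)
... | inj₁ refl | inj₂ refl | inj₁ refl = inj₂ refl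
... | inj₁ refl | inj₂ refl | inj₂ refl = inj₁ refl
... | inj₂ refl | inj₁ refl | inj₁ refl = inj₁ refl
... | inj₂ refl | inj₁ refl | inj₂ refl = inj₂ refl
... | inj₂ refl | inj₂ refl | _         = ⊥-elim (f≢h refl)

Unique-++ˡ : ∀ (xs : List A) {ys} → Unique (xs ++ ys) → Unique xs
Unique-++ˡ []       _        = []
Unique-++ˡ (x ∷ xs) (x∉ ∷ u) = All.tabulate (λ p → All.lookup x∉ (∈-++⁺ˡ p)) ∷ Unique-++ˡ xs u

Unique-++-disjoint : ∀ (xs : List A) {ys} → Unique (xs ++ ys) → ∀ {x} → x List.∈ xs → ¬ x List.∈ ys
Unique-++-disjoint (x ∷ xs) (x∉ ∷ _) (here refl) q = All.lookup x∉ (∈-++⁺ʳ xs q) refl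
Unique-++-disjoint (x ∷ xs) (_ ∷ u)  (there p)   q = Unique-++-disjoint xs u p q

module _ (G : List (Subset n)) (X : Subset n) where

  -- A walk in the dual multigraph: its nodes are edges of the hypergraph,
  -- and consecutive nodes share a vertex lying in no other edge.
  data Walk : Subset n → Subset n → List (Fin n) → Set where
    nil  : ∀ {a} → Walk a a []
    cons : ∀ {a b c v vs} → v ∈ a → v ∈ c →
           (∀ {f} → Edge G X f → v ∈ f → f ≡ a ⊎ f ≡ c) →
           Walk c b vs → Walk a b (v ∷ vs)

  Meets : Subset n → List (Fin n) → Set
  Meets f xs = ∃[ x ] x List.∈ xs × x ∈ f

  meets-⊆ : ∀ {f xs ys} → xs List.⊆ ys → Meets f xs → Meets f ys
  meets-⊆ s (x , p , q) = x , s p , q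

  -- An inner node of a walk contains two consecutive vertices of it, hence both an even and an odd one.
  walk-evens : ∀ {a b vs} → Walk a b vs → ∀ {f} → Edge G X f → Meets f (evens vs) →
    Meets f (odds vs) ⊎ f ≡ a ⊎ (f ≡ b × length (evens vs) ≡ suc (length (odds vs)))
  walk-odds : ∀ {a b vs} → Walk a b vs → ∀ {f} → Edge G X f → Meets f (odds vs) →
    Meets f (evens vs) ⊎ (f ≡ b × length (evens vs) ≡ length (odds vs))
  walk-evens (cons v∈a v∈c only nil) E (v , here refl , v∈f) with only E v∈f
  ... | inj₁ e = inj₂ (inj₁ e)
  ... | inj₂ e = inj₂ (inj₂ (e , refl))
  walk-evens (cons v∈a v∈c only (cons w∈ _ _ _)) E (v , here refl , v∈f) with only E v∈f
  ... | inj₁ e    = inj₂ (inj₁ e)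
  ... | inj₂ refl = inj₁ (_ , here refl , w∈)
  walk-evens (cons v∈a v∈c only w) E (x , there p , x∈f) with walk-odds w E (x , p , x∈f)
  ... | inj₁ m = inj₁ m
  ... | inj₂ (e , l) = inj₂ (inj₂ (e , cong suc (sym l)))
  walk-odds (cons v∈a v∈c only w) E m with walk-evens w E m
  ... | inj₁ m′ = inj₁ (meets-⊆ there m′)
  ... | inj₂ (inj₁ refl) = inj₁ (_ , here refl , v∈c)
  ... | inj₂ (inj₂ (e , l)) = inj₂ (e , sym l)

  walk-length : ∀ {a b vs} → Walk a b vs →
    length (evens vs) ≡ length (odds vs) ⊎ length (evens vs) ≡ suc (length (odds vs))
  walk-length nil = inj₁ refl
  walk-length (cons _ _ _ w) with walk-length w
  ... | inj₁ e = inj₂ (cong suc (sym e))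
  ... | inj₂ e = inj₁ (sym e)

  -- The walk is cut at its first vertex in f: f is a node at that vertex, and it misses all earlier vertices.
  record Return (h b f : Subset n) (vs : List (Fin n)) : Set where
    field
      prefix suffix : List (Fin n)
      split : vs ≡ prefix ++ suffix
      walk  : Walk h f prefix
      end   : Meets f suffix ⊎ (f ≡ b × ∃[ u ] ∀ {x} → x List.∈ prefix → x ∈ f → x ≡ u)

  return : ∀ {h b vs f} → Walk h b vs → Edge G X f → Meets f vs → Return h b f vs
  return {f = f} (cons {v = v} {vs} v∈h v∈c only w) E m with v ∈? f
  return {f = f} (cons {v = v} {vs} v∈h v∈c only w) E m | yes v∈f with only E v∈f
  ... | inj₁ refl = record
    { prefix = [] ; suffix = v ∷ vs ; split = refl ; walk = nil ; end = inj₁ (v , here refl , v∈f) }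
  ... | inj₂ refl = record
    { prefix = v ∷ [] ; suffix = vs ; split = refl ; walk = cons v∈h v∈c only nil ; end = end w }
    where
    -- If the walk goes on beyond `f`, its next vertex lies in `f`. If it stops there, `f` is its
    -- last node and `v` is the one vertex of the prefix known to lie in `f`.
    end : ∀ {c b vs} → Walk c b vs →
          Meets c vs ⊎ (c ≡ b × ∃[ u ] ∀ {x} → x List.∈ v ∷ [] → x ∈ c → x ≡ u)
    end nil = inj₂ (refl , v , λ { (here e) _ → e })
    end (cons u∈ _ _ _) = inj₁ (_ , here refl , u∈)
  return (cons {v = v} v∈h v∈c only w) E (x , here refl , x∈f) | no v∉f = ⊥-elim (v∉f x∈f)
  return {f = f} (cons {v = v} v∈h v∈c only w) E (x , there p , x∈f) | no v∉f = record
    { prefix = v ∷ prefix ; suffix = suffix ; split = cong (v ∷_) split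
    ; walk = cons v∈h v∈c only walk ; end = end′ end }
    where
    open Return (return w E (x , p , x∈f))
    end′ : ∀ {b} → Meets f suffix ⊎ (f ≡ b × ∃[ u ] ∀ {x} → x List.∈ prefix → x ∈ f → x ≡ u) →
           Meets f suffix ⊎ (f ≡ b × ∃[ u ] ∀ {x} → x List.∈ v ∷ prefix → x ∈ f → x ≡ u)
    end′ (inj₁ m) = inj₁ m
    end′ (inj₂ (e , u , only-u)) = inj₂ (e , u , λ
      { (here refl) q → ⊥-elim (v∉f q) ; (there r) q → only-u r q })

  -- Without `deleted` the vertices of `isolated` lie in no edge, so removing both
  -- lists lowers k by at least half the number of vertices removed.
  record Reducible : Set where
    field
      isolated deleted : List (Fin n)
      isolated-unique  : Unique isolated
      isolated⊆X       : ∀ {v} → v List.∈ isolated → v ∈ X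
      avoids           : ∀ {v} → v List.∈ isolated → ¬ v List.∈ deleted
      hits             : ∀ {f} → Edge G X f → Meets f isolated → Meets f deleted
      nonempty         : 0 < length isolated
      balanced         : length deleted ≤ length isolated

  -- With an even number of vertices, deleting every other one, starting with `v`, meets every node,
  -- including `a`. With an odd number, the first and last vertices both remain at `a`; deleting `w`
  -- as well takes care of that edge and makes the two lists equally long.
  closed-walk : ∀ {a v vs w} → Walk a a (v ∷ vs) → Unique (v ∷ vs) →
    (∀ {x} → x List.∈ v ∷ vs → x ∈ X) → w ∈ a → ¬ w List.∈ v ∷ vs → Reducible
  closed-walk {a} {v} {vs} {w} W@(cons v∈a _ _ _) u ⊆X w∈a w∉ with walk-length W
  ... | inj₁ eq = record
    { isolated = odds (v ∷ vs) ; deleted = evens (v ∷ vs)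
    ; isolated-unique = odds-unique u
    ; isolated⊆X = λ p → ⊆X (odds-⊆ (v ∷ vs) p)
    ; avoids = λ p q → evens-odds-disjoint u q p
    ; hits = hits
    ; nonempty = subst (0 <_) eq (s≤s z≤n)
    ; balanced = ≤-reflexive eq }
    where
    hits : ∀ {f} → Edge G X f → Meets f (odds (v ∷ vs)) → Meets f (evens (v ∷ vs))
    hits E m with walk-odds W E m
    ... | inj₁ m′ = m′
    ... | inj₂ (refl , _) = v , here refl , v∈a
  ... | inj₂ eq = record
    { isolated = evens (v ∷ vs) ; deleted = w ∷ odds (v ∷ vs)
    ; isolated-unique = evens-unique u
    ; isolated⊆X = λ p → ⊆X (evens-⊆ (v ∷ vs) p)
    ; avoids = λ { p (here refl) → w∉ (evens-⊆ (v ∷ vs) p) ; p (there q) → evens-odds-disjoint u p q }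
    ; hits = hits
    ; nonempty = s≤s z≤n
    ; balanced = ≤-reflexive (sym eq) }
    where
    hits : ∀ {f} → Edge G X f → Meets f (evens (v ∷ vs)) → Meets f (w ∷ odds (v ∷ vs))
    hits E m with walk-evens W E m
    ... | inj₁ m′ = meets-⊆ there m′
    ... | inj₂ (inj₁ refl) = w , here refl , w∈a
    ... | inj₂ (inj₂ (refl , _)) = w , here refl , w∈a

  edge-through? : ∀ v h → Dec (∃[ f ] Edge G X f × v ∈ f × f ≢ h)
  edge-through? v h with Any.any? (λ f → (f ⊆? X) ×-dec (2 ≤? ∣ f ∣) ×-dec (v ∈? f) ×-dec ¬? (f ≟ˢ h)) G
  ... | yes p = let (f , f∈ , a , b , c , d) = List.find p in yes (f , (f∈ , a , b) , c , d)
  ... | no ¬p = no λ { (f , (f∈ , a , b) , c , d) → ¬p (List.lose f∈ (a , b , c , d)) }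

  module _ (two : ∀ {v} → v ∈ X → AtMostTwo G X v) {g₀ : Subset n} (big : 3 ≤ ∣ g₀ ∣) where

    -- The walk grows at its newest node `h`. If `h` is the only edge through `v`, deleting another
    -- vertex of `h` isolates `v`. Otherwise a second edge `f` through `v` either misses the walk
    -- and becomes the new node, or meets it and closes a cycle. Vertices of the walk are distinct,
    -- so there are at most `n` of them and the fuel cannot run out.
    extend : ∀ fuel {h vs} → Edge G X h → Walk h g₀ vs → Unique vs →
      (∀ {x} → x List.∈ vs → x ∈ X) → n < fuel + length vs →
      (∃[ v ] v ∈ h × ¬ v List.∈ vs) → Reducible
    extend zero E W u ⊆X lt _ = ⊥-elim (<-irrefl refl (<-≤-trans lt
      (≤-trans (length≤∣p∣ ⊤ _ u (λ _ → ∈⊤)) (∣p∣≤n ⊤))))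
    extend (suc fuel) {h} {vs} E@(h∈G , h⊆X , 2≤h) W u ⊆X lt (v , v∈h , v∉)
      with edge-through? v h
    ... | no none =
      let (w , w∈h , w∉v) = larger⇒∃ h (v ∷ []) 2≤h in record
      { isolated = v ∷ [] ; deleted = w ∷ [] ; isolated-unique = [] ∷ []
      ; isolated⊆X = λ { (here refl) → h⊆X v∈h }
      ; avoids = λ { (here e) (here e′) → w∉v (here (trans (sym e′) e)) }
      ; hits = λ { {f} F (_ , here refl , v∈f) → w , here refl , hit F v∈f w∈h }
      ; nonempty = s≤s z≤n ; balanced = ≤-refl }
      where
      hit : ∀ {f w} → Edge G X f → v ∈ f → w ∈ h → w ∈ f
      hit {f} F v∈f w∈h with f ≟ˢ h
      ... | yes refl = w∈h
      ... | no  f≢h  = ⊥-elim (none (f , F , v∈f , f≢h))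
    ... | yes (f , F , v∈f , f≢h) = advance (Any.any? (_∈? f) vs)
      where
      W′ = cons v∈f v∈h (exactly-two (two (h⊆X v∈h)) E v∈h F v∈f f≢h) W
      v∉vs : ∀ {x} → x List.∈ vs → v ≢ x
      v∉vs p refl = v∉ p
      u′ = All.tabulate v∉vs ∷ u
      ⊆X′ : ∀ {x} → x List.∈ v ∷ vs → x ∈ X
      ⊆X′ (here refl) = h⊆X v∈h
      ⊆X′ (there p)   = ⊆X p
      close : ∀ ps qs → vs ≡ ps ++ qs → Walk h f ps →
              Meets f qs ⊎ (f ≡ g₀ × ∃[ x₀ ] ∀ {x} → x List.∈ ps → x ∈ f → x ≡ x₀) → Reducible
      close ps qs refl w end = closed-walk
        (cons v∈f v∈h (exactly-two (two (h⊆X v∈h)) E v∈h F v∈f f≢h) w)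
        (All.tabulate (v∉vs ∘ ∈-++⁺ˡ) ∷ Unique-++ˡ ps u) (⊆X′ ∘ ⊆ps) (proj₁ (proj₂ (spare end))) (proj₂ (proj₂ (spare end)))
        where
        ⊆ps : ∀ {x} → x List.∈ v ∷ ps → x List.∈ v ∷ vs
        ⊆ps (here e)  = here e
        ⊆ps (there p) = there (∈-++⁺ˡ p)
        -- A vertex of the closing edge off the cycle: one from the part of the walk cut away, or,
        -- if `f` is the initial edge `g₀`, a third vertex besides `v` and `x₀`.
        spare : Meets f qs ⊎ (f ≡ g₀ × ∃[ x₀ ] ∀ {x} → x List.∈ ps → x ∈ f → x ≡ x₀) →
                ∃[ w ] w ∈ f × ¬ w List.∈ v ∷ ps
        spare (inj₁ (w , w∈qs , w∈f)) = w , w∈f , λ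
          { (here refl) → v∉ (∈-++⁺ʳ ps w∈qs) ; (there w∈ps) → Unique-++-disjoint ps u w∈ps w∈qs }
        spare (inj₂ (refl , x₀ , only-x₀)) =
          let (w , w∈f , w∉) = larger⇒∃ f (v ∷ x₀ ∷ []) big in w , w∈f , λ
          { (here e) → w∉ (here e) ; (there w∈ps) → w∉ (there (here (only-x₀ w∈ps w∈f))) }
      advance : Dec (Any (_∈ f) vs) → Reducible
      advance (no misses) = extend fuel F W′ u′ ⊆X′
        (subst (n <_) (sym (+-suc fuel (length vs))) lt)
        (let (w , w∈f , w≢v) = larger⇒∃ f (v ∷ []) (proj₂ (proj₂ F))
         in w , w∈f , λ { (here e) → w≢v (here e) ; (there p) → misses (List.lose p w∈f) })
      advance (yes meets) = close prefix suffix split walk end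
        where open Return (return W F (List.find meets))

    reducible : Edge G X g₀ → Reducible
    reducible E =
      let (v , v∈) = 0<∣p∣⇒nonempty g₀ (≤-trans (s≤s z≤n) big)
      in extend (suc n) E nil [] (λ ()) (s≤s (m≤m+n n 0)) (v , v∈ , λ ())

-- Existence of a vertex in three edges

private
  -- Removing `d + i` vertices, at most `2 * i`, while the number of members drops by `i` preserves
  -- the strict excess over twice that number.
  halve : ∀ {x d i k′ y} → 2 * (i + k′) < x → x ≤ y + (d + i) → d ≤ i → 2 * k′ < y
  halve {x} {d} {i} {k′} {y} lt x≤ d≤i = +-cancelʳ-< (2 * i) (2 * k′) y (begin-strict
    2 * k′ + 2 * i  ≡⟨ +-comm (2 * k′) (2 * i) ⟩
    2 * i + 2 * k′  ≡⟨ *-distribˡ-+ 2 i k′ ⟨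
    2 * (i + k′)    <⟨ lt ⟩
    x               ≤⟨ x≤ ⟩
    y + (d + i)     ≤⟨ +-monoʳ-≤ y (+-mono-≤ d≤i (m≤m+n i 0)) ⟩
    y + 2 * i       ∎)
    where open ≤-Reasoning

-- After removing `deleted`, each vertex of `isolated` lies in no edge, so its removal lowers `k` by
-- one. What is left is a counterexample with smaller `k`.
¬reducible : ∀ {G : List (Subset n)} {X} → Coverable G X k → 2 * k < ∣ X ∣ →
  (∀ {Y k′} → Y ⊆ X → k′ < k → Coverable G Y k′ → ¬ 2 * k′ < ∣ Y ∣) → ¬ Reducible G X
¬reducible {k = k} {G = G} {X} C big smaller R
  with delete-isolated* isolated isolated-unique
         (λ p → ∈-∖⁺ deleted (isolated⊆X p) (avoids p)) (coverable-⊆ (∖-⊆ deleted) C)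
         (λ {v} {g} v∈ g∈ g⊆ v∈g 2≤ →
            let (d , d∈ , d∈g) = hits (g∈ , (λ q → ∖-⊆ deleted (g⊆ q)) , 2≤) (v , v∈ , v∈g)
            in ∈-∖⁻ deleted (g⊆ d∈g) d∈)
  where open Reducible R
... | k′ , refl , C′ = smaller (λ q → ∖-⊆ deleted (∖-⊆ isolated q))
        (m<n+m k′ nonempty) C′ (halve {d = length deleted} {i = length isolated} big size≤ balanced)
  where
  open Reducible R
  open ≤-Reasoning
  size≤ : ∣ X ∣ ≤ ∣ (X ∖ deleted) ∖ isolated ∣ + (length deleted + length isolated)
  size≤ = begin
    ∣ X ∣                                 ≤⟨ ∣p∣≤∣p∖xs∣+length X deleted ⟩
    ∣ X ∖ deleted ∣ + length deleted       ≤⟨ +-monoˡ-≤ _ (∣p∣≤∣p∖xs∣+length (X ∖ deleted) isolated) ⟩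
    ∣ (X ∖ deleted) ∖ isolated ∣ + length isolated + length deleted
      ≡⟨ +-assoc ∣ (X ∖ deleted) ∖ isolated ∣ (length isolated) _ ⟩
    ∣ (X ∖ deleted) ∖ isolated ∣ + (length isolated + length deleted)
      ≡⟨ cong (∣ (X ∖ deleted) ∖ isolated ∣ +_) (+-comm (length isolated) _) ⟩
    ∣ (X ∖ deleted) ∖ isolated ∣ + (length deleted + length isolated) ∎

-- If no member inside `X` had three elements, `k` members would cover at most `2 * k` points. So
-- there is a large edge from which to start a walk, and the resulting reduction leads to a smaller
-- `k`. The degree condition survives, since edges inside a subset of `X` are edges inside `X`.
¬all-at-most-two : ∀ {G : List (Subset n)} {X} → Acc _<_ k → Coverable G X k → 2 * k < ∣ X ∣ →
  ¬ (∀ {v} → v ∈ X → AtMostTwo G X v)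
¬all-at-most-two {k = k} {G = G} {X} (acc rec) C big two
  with Any.any? (λ f → (f ⊆? X) ×-dec (3 ≤? ∣ f ∣)) G
... | no none = <⇒≱ big (subst (∣ X ∣ ≤_) (*-comm k 2) (hitting-bound 2 [] C λ g∈ g⊆ lt →
        ⊥-elim (none (List.lose g∈ (g⊆ , lt)))))
... | yes some =
  let (g₀ , g∈ , g⊆ , 3≤) = List.find some in
  ¬reducible C big
    (λ Y⊆X k′<k C′ big′ → ¬all-at-most-two (rec k′<k) C′ big′ λ v∈Y →
       let (g , h , t) = two (Y⊆X v∈Y) in g , h , λ { (f∈ , f⊆ , 2≤) → t (f∈ , (λ q → Y⊆X (f⊆ q)) , 2≤) })
    (reducible G X two 3≤ (g∈ , g⊆ , ≤-trans (n≤1+n 2) 3≤))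

-- Counting edges

Edge? : ∀ (X g : Subset n) → Dec (g ⊆ X × 2 ≤ ∣ g ∣)
Edge? X g = (g ⊆? X) ×-dec (2 ≤? ∣ g ∣)

edges : List (Subset n) → Subset n → List (Subset n)
edges G X = filter (Edge? X) G

star : List (Subset n) → Subset n → Fin n → List (Subset n)
star G X z = filter (z ∈?_) (edges G X)

star⊆edges : ∀ (G : List (Subset n)) X z → star G X z List.⊆ edges G X
star⊆edges G X z p = proj₁ (∈-filter⁻ (z ∈?_) {xs = edges G X} p)

length≤2⇒at-most-two : ∀ (x₀ : A) xs → length xs ≤ 2 → ∃[ g ] ∃[ h ] ∀ {f} → f List.∈ xs → f ≡ g ⊎ f ≡ h
length≤2⇒at-most-two x₀ [] _ = x₀ , x₀ , λ ()
length≤2⇒at-most-two x₀ (x ∷ []) _ = x , x , λ { (here e) → inj₁ e }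
length≤2⇒at-most-two x₀ (x ∷ y ∷ []) _ = x , y , λ { (here e) → inj₁ e ; (there (here e)) → inj₂ e }
length≤2⇒at-most-two x₀ (x ∷ y ∷ z ∷ xs) (s≤s (s≤s ()))

high-degree : ∀ {G : List (Subset n)} {X} → Coverable G X k → 2 * k < ∣ X ∣ →
  ∃[ z ] z ∈ X × 3 ≤ length (star G X z)
high-degree {k = k} {G = G} {X} C big with Fin.any? (λ z → (z ∈? X) ×-dec (3 ≤? length (star G X z)))
... | yes r = r
... | no none = ⊥-elim (¬all-at-most-two (<-wellFounded k) C big λ {v} v∈X →
  let (g , h , t) = length≤2⇒at-most-two ⊤ (star G X v) (ℕ.s≤s⁻¹ (≰⇒> λ 3≤ → none (v , v∈X , 3≤)))
  in g , h , λ { (f∈ , f⊆ , 2≤) v∈f → t (∈-filter⁺ (v ∈?_) (∈-filter⁺ (Edge? X) f∈ ((λ {x} → f⊆ {x}) , 2≤)) v∈f) })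

edges-delete : ∀ {G : List (Subset n)} X z → Unique G →
  length (edges G (X - z)) + length (star G X z) ≤ length (edges G X)
edges-delete {G = G} X z u = subst (_≤ length (edges G X)) (length-++ (edges G (X - z)))
  (unique-⊆⇒length≤
    (Unique.++⁺ (Unique.filter⁺ (Edge? (X - z)) u)
                (Unique.filter⁺ (z ∈?_) (Unique.filter⁺ (Edge? X) u))
                (λ { (p , q) → x∉p-x X z (proj₁ (proj₂ (∈-filter⁻ (Edge? (X - z)) {xs = G} p))
                                           (proj₂ (∈-filter⁻ (z ∈?_) {xs = edges G X} q))) }))
    sub)
  where
  sub : edges G (X - z) ++ star G X z List.⊆ edges G X
  sub p with ∈-++⁻ (edges G (X - z)) p
  ... | inj₁ q = let (g∈ , g⊆ , 2≤) = ∈-filter⁻ (Edge? (X - z)) {xs = G} q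
                 in ∈-filter⁺ (Edge? X) g∈ ((λ {x} x∈ → p-x⊆p X z (g⊆ x∈)) , 2≤)
  ... | inj₂ q = star⊆edges G X z q

-- Choosing one point per set turns the bounds on hitting lists into bounds on the number of sets.
representatives : ∀ (gs : List (Subset n)) → (∀ {g} → g List.∈ gs → Nonempty g) →
  ∃[ ds ] length ds ≡ length gs × (∀ {g} → g List.∈ gs → ∃[ d ] d List.∈ ds × d ∈ g)
representatives [] _ = [] , refl , λ ()
representatives (g ∷ gs) ne with ne (here refl) | representatives gs (ne ∘ there)
... | d , d∈ | ds , len , hit = d ∷ ds , cong suc len , λ
  { (here refl) → d , here refl , d∈ ; (there p) → let (e , e∈ , e∈g) = hit p in e , there e∈ , e∈g }

-- The case `s = 1` of `hitting-bound`: once every edge is hit, members avoiding `ds` have at most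
-- one element.
edge-hitting-bound : ∀ {G : List (Subset n)} {X} → Coverable G X k → ∀ ds →
  (∀ {g} → g List.∈ edges G X → ∃[ d ] d List.∈ ds × d ∈ g) → ∣ X ∣ ≤ length ds + k
edge-hitting-bound {k = k} {G = G} {X} C ds hit = subst (λ m → ∣ X ∣ ≤ length ds + m) (*-identityʳ k)
  (hitting-bound 1 ds C λ g∈ g⊆ lt → hit (∈-filter⁺ (Edge? X) g∈ ((λ {x} → g⊆ {x}) , lt)))

edge-nonempty : ∀ (G : List (Subset n)) X {g} → g List.∈ edges G X → Nonempty g
edge-nonempty G X {g} g∈ =
  0<∣p∣⇒nonempty g (≤-trans (s≤s z≤n) (proj₂ (proj₂ (∈-filter⁻ (Edge? X) {xs = G} g∈))))

-- There are at least `3 * ∣ X ∣ - 5 * k` edges, written without subtraction. If `∣ X ∣` exceeds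
-- `2 * k`, deleting a vertex of degree at least three lowers the right side by at least three and
-- the left by exactly three. Otherwise one point per edge gives `∣ X ∣` at most the number of edges
-- plus `k`, and the other `2 * ∣ X ∣` is at most `4 * k`.
edges-lower-bound : ∀ {G : List (Subset n)} → Unique G → ∀ m X → ∣ X ∣ ≤ m → Coverable G X k →
  3 * ∣ X ∣ ≤ length (edges G X) + 5 * k
edges-lower-bound {k = k} {G} u m X ≤m C with 2 * k <? ∣ X ∣
... | no ≮ =
  let (ds , len , hit) = representatives (edges G X) (edge-nonempty G X)
  in begin
  3 * ∣ X ∣                             ≡⟨ solve₁ ∣ X ∣ ⟩
  ∣ X ∣ + 2 * ∣ X ∣                     ≤⟨ +-mono-≤ (edge-hitting-bound C ds hit) (*-monoʳ-≤ 2 (≮⇒≥ ≮)) ⟩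
  length ds + k + 2 * (2 * k)           ≡⟨ cong (λ d → d + k + 2 * (2 * k)) len ⟩
  length (edges G X) + k + 2 * (2 * k)  ≡⟨ solve₂ (length (edges G X)) k ⟩
  length (edges G X) + 5 * k            ∎
  where
  open ≤-Reasoning
  solve₁ : ∀ x → 3 * x ≡ x + 2 * x
  solve₁ = solve-∀
  solve₂ : ∀ e k → e + k + 2 * (2 * k) ≡ e + 5 * k
  solve₂ = solve-∀
edges-lower-bound u zero X ≤m C | yes big = ⊥-elim (n≮0 (<-≤-trans big ≤m))
edges-lower-bound {k = k} {G} u (suc m) X ≤m C | yes big =
  let (z , z∈X , 3≤) = high-degree C big
      ih = edges-lower-bound u m (X - z) (ℕ.s≤s⁻¹ (≤-trans (x∈p⇒∣p-x∣<∣p∣ z∈X) ≤m))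
             (coverable-⊆ (p-x⊆p X z) C)
  in begin
  3 * ∣ X ∣                                                    ≡⟨ cong (3 *_) (∣p-x∣+1 z∈X) ⟩
  3 * suc ∣ X - z ∣                                            ≡⟨ *-suc 3 ∣ X - z ∣ ⟩
  3 + 3 * ∣ X - z ∣                                            ≤⟨ +-mono-≤ 3≤ ih ⟩
  length (star G X z) + (length (edges G (X - z)) + 5 * k)     ≡⟨ solve₁ (length (star G X z)) (length (edges G (X - z))) (5 * k) ⟩
  (length (edges G (X - z)) + length (star G X z)) + 5 * k     ≤⟨ +-monoˡ-≤ (5 * k) (edges-delete X z u) ⟩
  length (edges G X) + 5 * k                                   ∎
  where
  open ≤-Reasoning
  solve₁ : ∀ a b c → a + (b + c) ≡ b + a + c
  solve₁ = solve-∀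

-- Singletons and the lower bounds by size of members

⊆⁅x⁆⇒≡ : ∀ {g : Subset n} {x} → x ∈ g → g ⊆ ⁅ x ⁆ → g ≡ ⁅ x ⁆
⊆⁅x⁆⇒≡ {x = x} x∈ g⊆ = ⊆-antisym g⊆ λ y∈ → subst (_∈ _) (sym (x∈⁅y⁆⇒x≡y x y∈)) x∈

singleton∈ : ∀ {G : List (Subset n)} {X x} → Coverable G X k → x ∈ X → ⁅ x ⁆ List.∈ G
singleton∈ {G = G} {X} {x} C x∈X =
  let c = C ⁅ x ⁆ (λ y∈ → subst (_∈ X) (sym (x∈⁅y⁆⇒x≡y x y∈)) x∈X)
      (h , h∈ , x∈h) = onto c (x∈⁅x⁆ x)
  in subst (List._∈ G) (⊆⁅x⁆⇒≡ x∈h (within c h∈)) (from c h∈)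

singletons : ∀ n → List (Subset n)
singletons n = map ⁅_⁆ (allFin n)

length-singletons : ∀ n → length (singletons n) ≡ n
length-singletons n = trans (length-map ⁅_⁆ (allFin n)) (length-tabulate {n = n} id)

⁅⁆-injective : ∀ {x y : Fin n} → ⁅ x ⁆ ≡ ⁅ y ⁆ → x ≡ y
⁅⁆-injective {x = x} {y} e = x∈⁅y⁆⇒x≡y y (subst (x ∈_) e (x∈⁅x⁆ x))

module _ {G : List (Subset n)} (u : Unique G) (C : Coverable G ⊤ k) where

  singletons∪edges-unique : Unique (singletons n ++ edges G ⊤)
  singletons∪edges-unique = Unique.++⁺ (Unique.map⁺ ⁅⁆-injective (Unique.allFin⁺ n))
    (Unique.filter⁺ (Edge? ⊤) u) disjoint′
    where
    disjoint′ : ∀ {s} → ¬ (s List.∈ singletons n × s List.∈ edges G ⊤)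
    disjoint′ (p , q) with ∈-map⁻ ⁅_⁆ p
    ... | x , _ , refl = <-irrefl (sym (∣⁅x⁆∣≡1 x)) (proj₂ (proj₂ (∈-filter⁻ (Edge? ⊤) {xs = G} q)))

  singletons∪edges-⊆ : ∀ {s} → s List.∈ singletons n ++ edges G ⊤ → s List.∈ G × 1 ≤ ∣ s ∣
  singletons∪edges-⊆ p with ∈-++⁻ (singletons n) p
  ... | inj₂ q = let (s∈ , _ , 2≤) = ∈-filter⁻ (Edge? ⊤) {xs = G} q in s∈ , ≤-trans (s≤s z≤n) 2≤
  ... | inj₁ q with ∈-map⁻ ⁅_⁆ q
  ...   | x , _ , refl = singleton∈ C ∈⊤ , ≤-reflexive (sym (∣⁅x⁆∣≡1 x))

  length-singletons∪edges : length (singletons n ++ edges G ⊤) ≡ n + length (edges G ⊤)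
  length-singletons∪edges =
    trans (length-++ (singletons n)) (cong (_+ length (edges G ⊤)) (length-singletons n))

  edges-lower-bound-⊤ : 3 * n ≤ length (edges G ⊤) + 5 * k
  edges-lower-bound-⊤ = subst (λ m → 3 * m ≤ length (edges G ⊤) + 5 * k) (∣⊤∣≡n n)
    (edges-lower-bound u n ⊤ (∣p∣≤n ⊤) C)

  -- The `n` singletons add to the `3 * n - 5 * k` edges, from which they are disjoint.
  size≥1 : 4 * n ≤ size (family G u ≥∣ 1 ∣) + 5 * k
  size≥1 = begin
    4 * n                                        ≡⟨⟩
    n + 3 * n                                    ≤⟨ +-monoʳ-≤ n edges-lower-bound-⊤ ⟩
    n + (length (edges G ⊤) + 5 * k)             ≡⟨ +-assoc n _ _ ⟨
    n + length (edges G ⊤) + 5 * k               ≡⟨ cong (_+ 5 * k) length-singletons∪edges ⟨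
    length (singletons n ++ edges G ⊤) + 5 * k   ≤⟨ +-monoˡ-≤ (5 * k) (unique-⊆⇒length≤ singletons∪edges-unique
      λ p → let (s∈ , 1≤) = singletons∪edges-⊆ p in ∈-filter⁺ (λ g → 1 ≤? ∣ g ∣) s∈ 1≤) ⟩
    size (family G u ≥∣ 1 ∣) + 5 * k             ∎
    where open ≤-Reasoning

  size≥2 : 3 * n ≤ size (family G u ≥∣ 2 ∣) + 5 * k
  size≥2 = ≤-trans edges-lower-bound-⊤ (+-monoˡ-≤ (5 * k)
    (unique-⊆⇒length≤ (Unique.filter⁺ (Edge? ⊤) u) λ p →
      let (s∈ , _ , 2≤) = ∈-filter⁻ (Edge? ⊤) {xs = G} p in ∈-filter⁺ (λ g → 2 ≤? ∣ g ∣) s∈ 2≤))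

  -- One point from each member of size at least 3 is removed; `k` members of size at most 2 must
  -- cover the rest.
  size≥3 : n ≤ size (family G u ≥∣ 3 ∣) + k * 2
  size≥3 =
    let (ds , len , hit) = representatives (members (family G u ≥∣ 3 ∣)) λ {g} g∈ →
          0<∣p∣⇒nonempty g (≤-trans (s≤s z≤n) (proj₂ (∈-filter⁻ (λ g → 3 ≤? ∣ g ∣) {xs = G} g∈)))
    in subst₂ (λ a b → a ≤ b + k * 2) (∣⊤∣≡n n) len (hitting-bound 2 ds C λ g∈ _ lt →
         hit (∈-filter⁺ (λ g → 3 ≤? ∣ g ∣) g∈ lt))

  -- Three edges pass through `z`, and its singleton is the fourth member.
  large-degree : 2 * k < n → ∃[ z ] 4 ≤ degree z (family G u)
  large-degree big =
    let (z , _ , 3≤) = high-degree C (subst (2 * k <_) (sym (∣⊤∣≡n n)) big)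
    in z , ≤-trans (s≤s 3≤) (unique-⊆⇒length≤
      (All.tabulate (λ { p refl → <-irrefl (sym (∣⁅x⁆∣≡1 z))
        (proj₂ (proj₂ (∈-filter⁻ (Edge? ⊤) {xs = G} (star⊆edges G ⊤ z p)))) })
        ∷ Unique.filter⁺ (z ∈?_) (Unique.filter⁺ (Edge? ⊤) u))
      λ { (here refl) → ∈-filter⁺ (z ∈?_) (singleton∈ C ∈⊤) (x∈⁅x⁆ z)
        ; (there p) → let (q , z∈) = ∈-filter⁻ (z ∈?_) {xs = edges G ⊤} p
                      in ∈-filter⁺ (z ∈?_) (proj₁ (∈-filter⁻ (Edge? ⊤) {xs = G} q)) z∈ })

-- Colourings and the perfect matching

DisjointlyCoverable : List (Subset n) → Subset n → ℕ → Set
DisjointlyCoverable G X k = ∀ S → S ⊆ X → Σ[ c ∈ Cover G k S ] AllPairs Disjoint (parts c)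

Monochromatic : (Fin n → Fin k) → Subset n → Set
Monochromatic χ g = ∀ {x y} → x ∈ g → y ∈ g → χ x ≡ χ y

-- Every class has two or three points in `X`. The upper bound is a list of three candidates, which
-- may repeat, so a class of two needs no separate form.
record Balanced (X : Subset n) (χ : Fin n → Fin k) : Set where
  field
    two-of   : ∀ i → ∃[ a ] ∃[ b ] (a ∈ X × b ∈ X) × a ≢ b × χ a ≡ i × χ b ≡ i
    three-of : ∀ i → ∃[ a ] ∃[ b ] ∃[ c ] ∀ {x} → x ∈ X → χ x ≡ i → x List.∈ a ∷ b ∷ c ∷ []

-- The parts V₁, …, V_k are represented by the colour classes of χ within X.
record Colouring (G : List (Subset n)) (X : Subset n) (k : ℕ) : Set where
  field
    χ        : Fin n → Fin k
    balanced : Balanced X χ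
    mono⇒∈   : ∀ {g} → g ⊆ X → 2 ≤ ∣ g ∣ → Monochromatic χ g → g List.∈ G
    ∈⇒mono   : ∀ {g} → Edge G X g → Monochromatic χ g

lookup-injective : ∀ {xs : List A} → Unique xs → ∀ {i j} → lookup xs i ≡ lookup xs j → i ≡ j
lookup-injective {xs = x ∷ xs} _        {zero}  {zero}  e = refl
lookup-injective {xs = x ∷ xs} (x∉ ∷ _) {zero}  {suc j} e = ⊥-elim (All.lookup x∉ (∈-lookup j) e)
lookup-injective {xs = x ∷ xs} (x∉ ∷ _) {suc i} {zero}  e = ⊥-elim (All.lookup x∉ (∈-lookup i) (sym e))
lookup-injective {xs = x ∷ xs} (_ ∷ u)  {suc i} {suc j} e = cong suc (lookup-injective u e)

index-injective : ∀ {x y : A} {xs} (p : x List.∈ xs) (q : y List.∈ xs) → Any.index p ≡ Any.index q → x ≡ y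
index-injective {xs = xs} p q e = trans (Any.lookup-index p) (trans (cong (lookup xs) e) (sym (Any.lookup-index q)))

⊆∧∣∣≤⇒≡ : ∀ {p q : Subset n} → p ⊆ q → ∣ q ∣ ≤ ∣ p ∣ → p ≡ q
⊆∧∣∣≤⇒≡ {p = p} {q} p⊆q le = ⊆-antisym p⊆q q⊆p
  where
  q⊆p : q ⊆ p
  q⊆p {x} x∈q with x ∈? p
  ... | yes x∈p = x∈p
  ... | no  x∉p = ⊥-elim (<⇒≱ (p⊂q⇒∣p∣<∣q∣ (p⊆q , x , x∈q , x∉p)) le)

disjoint-∷ : ∀ s t (p q : Subset n) → Disjoint (s ∷ p) (t ∷ q) → Disjoint p q
disjoint-∷ _ _ _ _ d (x , x∈) = d (suc x , there x∈)

∣p∣+∣q∣≤∣p∪q∣ : ∀ (p q : Subset n) → Disjoint p q → ∣ p ∣ + ∣ q ∣ ≤ ∣ p ∪ q ∣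
∣p∣+∣q∣≤∣p∪q∣ [] [] d = z≤n
∣p∣+∣q∣≤∣p∪q∣ (outside ∷ p) (outside ∷ q) d = ∣p∣+∣q∣≤∣p∪q∣ p q (disjoint-∷ outside outside p q d)
∣p∣+∣q∣≤∣p∪q∣ (inside  ∷ p) (outside ∷ q) d = s≤s (∣p∣+∣q∣≤∣p∪q∣ p q (disjoint-∷ inside outside p q d))
∣p∣+∣q∣≤∣p∪q∣ (outside ∷ p) (inside  ∷ q) d =
  subst (_≤ suc ∣ p ∪ q ∣) (sym (+-suc ∣ p ∣ ∣ q ∣)) (s≤s (∣p∣+∣q∣≤∣p∪q∣ p q (disjoint-∷ outside inside p q d)))
∣p∣+∣q∣≤∣p∪q∣ (inside  ∷ p) (inside  ∷ q) d = ⊥-elim (d (zero , here))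

sum≤∣X∣ : ∀ (gs : List (Subset n)) {X} → AllPairs Disjoint gs → (∀ {g} → g List.∈ gs → g ⊆ X) →
          sum (map ∣_∣ gs) ≤ ∣ X ∣
sum≤∣X∣ gs {X} d sub = ≤-trans (sum≤∣⋃∣ gs d)
  (p⊆q⇒∣p∣≤∣q∣ λ x∈ → let (_ , g∈ , x∈g) = ∈-⋃⁻ gs x∈ in sub g∈ x∈g)
  where
  sum≤∣⋃∣ : ∀ gs → AllPairs Disjoint gs → sum (map ∣_∣ gs) ≤ ∣ ⋃ gs ∣
  sum≤∣⋃∣ [] _ = z≤n
  sum≤∣⋃∣ (g ∷ gs) (d ∷ ds) = ≤-trans (+-monoʳ-≤ ∣ g ∣ (sum≤∣⋃∣ gs ds))
    (∣p∣+∣q∣≤∣p∪q∣ g (⋃ gs) λ { (x , x∈) →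
      let (x∈g , x∈⋃) = x∈p∩q⁻ g (⋃ gs) x∈
          (_ , h∈ , x∈h) = ∈-⋃⁻ gs x∈⋃
      in disjoint-∉ (All.lookup d h∈) x∈g x∈h })

2*length≤sum : ∀ (gs : List (Subset n)) → (∀ {g} → g List.∈ gs → 2 ≤ ∣ g ∣) → 2 * length gs ≤ sum (map ∣_∣ gs)
2*length≤sum [] _ = z≤n
2*length≤sum (g ∷ gs) f = subst (_≤ sum (map ∣_∣ (g ∷ gs))) (sym (*-suc 2 (length gs)))
  (+-mono-≤ (f (here refl)) (2*length≤sum gs (f ∘ there)))

sum≤2*length⇒≤2 : ∀ (gs : List (Subset n)) → (∀ {g} → g List.∈ gs → 2 ≤ ∣ g ∣) →
  sum (map ∣_∣ gs) ≤ 2 * length gs → ∀ {g} → g List.∈ gs → ∣ g ∣ ≤ 2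
sum≤2*length⇒≤2 (g ∷ gs) f le (here refl) = +-cancelʳ-≤ (2 * length gs) ∣ g ∣ 2
  (≤-trans (+-monoʳ-≤ ∣ g ∣ (2*length≤sum gs (f ∘ there))) (≤-trans le (≤-reflexive (*-suc 2 (length gs)))))
sum≤2*length⇒≤2 (g ∷ gs) f le (there p) = sum≤2*length⇒≤2 gs (f ∘ there)
  (+-cancelˡ-≤ 2 _ _ (≤-trans (+-monoˡ-≤ _ (f (here refl))) (≤-trans le (≤-reflexive (*-suc 2 (length gs)))))) p

pair-elements : ∀ {g : Subset n} → 2 ≤ ∣ g ∣ → ∣ g ∣ ≤ 2 →
  ∃[ a ] ∃[ b ] (a ∈ g × b ∈ g) × a ≢ b × (∀ {x} → x ∈ g → x ≡ a ⊎ x ≡ b)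
pair-elements {g = g} 2≤ ≤2 =
  let (a , a∈ , _)  = larger⇒∃ g [] (≤-trans (s≤s z≤n) 2≤)
      (b , b∈ , b∉) = larger⇒∃ g (a ∷ []) 2≤
      b≢a = λ e → b∉ (here e)
  in a , b , (a∈ , b∈) , b≢a ∘ sym , only a∈ b∈ b≢a
  where
  only : ∀ {a b} → a ∈ g → b ∈ g → b ≢ a → ∀ {x} → x ∈ g → x ≡ a ⊎ x ≡ b
  only {a} {b} a∈ b∈ b≢a {x} x∈ with x Fin.≟ a | x Fin.≟ b
  ... | yes e | _     = inj₁ e
  ... | no _  | yes e = inj₂ e
  ... | no x≢a | no x≢b = ⊥-elim (<⇒≱ (length≤∣p∣ g (x ∷ a ∷ b ∷ [])
    ((x≢a ∷ x≢b ∷ []) ∷ ((b≢a ∘ sym) ∷ []) ∷ [] ∷ [])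
    (λ { (here refl) → x∈ ; (there (here refl)) → a∈ ; (there (there (here refl))) → b∈ })) ≤2)

-- If two of the sets share a point, that point represents both and one representative is saved.
few-hit-or-disjoint : ∀ (gs : List (Subset n)) → (∀ {g} → g List.∈ gs → Nonempty g) →
  AllPairs Disjoint gs ⊎
  (∃[ ds ] length ds < length gs × (∀ {g} → g List.∈ gs → ∃[ d ] d List.∈ ds × d ∈ g))
few-hit-or-disjoint [] _ = inj₁ []
few-hit-or-disjoint (g ∷ gs) ne with Any.any? (λ h → nonempty? (g ∩ h)) gs
... | yes meet with List.find meet
...   | h , h∈ , x , x∈g∩h with x∈p∩q⁻ g h x∈g∩h | ∈-∃++ h∈
...     | x∈g , x∈h | as , bs , refl with representatives (as ++ bs) (λ p → ne (there (insert as p)))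
  where
  insert : ∀ (as : List (Subset _)) {bs f h} → f List.∈ as ++ bs → f List.∈ as ++ h ∷ bs
  insert as p with ∈-++⁻ as p
  ... | inj₁ q = ∈-++⁺ˡ q
  ... | inj₂ q = ∈-++⁺ʳ as (there q)
...       | ds , len , hit = inj₂ (x ∷ ds ,
    ≤-reflexive (cong suc (trans (cong suc len) (sym (length-++-sucʳ as h bs)))) , λ
    { (here refl) → x , here refl , x∈g ; {f} (there p) → others f p })
  where
  others : ∀ f → f List.∈ as ++ h ∷ bs → ∃[ d ] d List.∈ x ∷ ds × d ∈ f
  others f p with f ≟ˢ h
  ... | yes refl = x , here refl , x∈h
  ... | no f≢h = let (d , d∈ , d∈f) = hit (remove-mid as f≢h p) in d , there d∈ , d∈f
few-hit-or-disjoint (g ∷ gs) ne | no apart with few-hit-or-disjoint gs (ne ∘ there)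
... | inj₁ ds = inj₁ (All.tabulate (λ h∈ meet → apart (List.lose h∈ meet)) ∷ ds)
... | inj₂ (ds , lt , hit) = let (x , x∈g) = ne (here refl) in inj₂ (x ∷ ds , s≤s lt , λ
    { (here refl) → x , here refl , x∈g ; (there p) → let (d , d∈ , d∈g) = hit p in d , there d∈ , d∈g })

-- Two meeting edges would allow fewer points than edges to hit all edges, against
-- `edge-hitting-bound`. So the edges are disjoint, and as `X` has only twice as many points as
-- there are edges, they are pairs and exhaust `X`. The colour of a point is the index of its pair.
matching-colouring : ∀ {G : List (Subset n)} {X} → Fin (length (edges G X)) → Unique G →
  Coverable G X (length (edges G X)) → ∣ X ∣ ≡ 2 * length (edges G X) → Colouring G X (length (edges G X))
matching-colouring {n = n} {G = G} {X} i₀ u C size≡ = record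
  { χ = χ
  ; balanced = record { two-of = two ; three-of = three }
  ; mono⇒∈ = mono⇒∈
  ; ∈⇒mono = λ { (f∈ , f⊆ , 2≤) x∈ y∈ → let f∈L = ∈-filter⁺ (Edge? X) f∈ ((λ {x} → f⊆ {x}) , 2≤)
                 in lookup-injective uL (trans (lookup-χ f∈L x∈) (sym (lookup-χ f∈L y∈))) }
  }
  where
  L = edges G X
  uL : Unique L
  uL = Unique.filter⁺ (Edge? X) u
  L∈ : ∀ {g} → g List.∈ L → g List.∈ G × g ⊆ X × 2 ≤ ∣ g ∣
  L∈ p = ∈-filter⁻ (Edge? X) {xs = G} p
  pairwise : AllPairs Disjoint L
  pairwise with few-hit-or-disjoint L (edge-nonempty G X)
  ... | inj₁ d = d
  ... | inj₂ (ds , lt , hit) = ⊥-elim (<⇒≱ (+-monoˡ-< (length L) lt)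
    (≤-trans (≤-reflexive (trans (solve₁ (length L)) (sym size≡))) (edge-hitting-bound C ds hit)))
    where
    solve₁ : ∀ l → l + l ≡ 2 * l
    solve₁ = solve-∀
  2≤L : ∀ {g} → g List.∈ L → 2 ≤ ∣ g ∣
  2≤L p = proj₂ (proj₂ (L∈ p))
  L≤2 : ∀ {g} → g List.∈ L → ∣ g ∣ ≤ 2
  L≤2 = sum≤2*length⇒≤2 L 2≤L (≤-trans (sum≤∣X∣ L pairwise λ p → proj₁ (proj₂ (L∈ p))) (≤-reflexive size≡))
  covered : ∀ {x} → x ∈ X → Any (x ∈_) L
  covered {x} x∈X with Any.any? (x ∈?_) L
  ... | yes p = p
  -- If no edge contained `x`, all the disjoint edges would fit into `X - x`, which has too few
  -- points.
  ... | no ¬p = ⊥-elim (<⇒≱ (x∈p⇒∣p-x∣<∣p∣ x∈X) (≤-trans (≤-reflexive size≡) (≤-trans (2*length≤sum L 2≤L)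
          (sum≤∣X∣ L {X - x} pairwise λ p y∈ → x∈p∧x≢y⇒x∈p-y (proj₁ (proj₂ (L∈ p)) y∈) λ { refl → ¬p (List.lose p y∈) }))))
  χ : Fin n → Fin (length L)
  χ x with Any.any? (x ∈?_) L
  ... | yes p = Any.index p
  -- A default colour, taken only by points outside `X`.
  ... | no  _ = i₀
  lookup-χ : ∀ {x g} → g List.∈ L → x ∈ g → lookup L (χ x) ≡ g
  lookup-χ {x} {g} g∈ x∈ with Any.any? (x ∈?_) L
  ... | no ¬p = ⊥-elim (¬p (List.lose g∈ x∈))
  ... | yes p with lookup L (Any.index p) ≟ˢ g
  ...   | yes e = e
  ...   | no ≢g = ⊥-elim (disjoint-∉ (AllPairs-lookup disjoint-sym pairwise (∈-lookup (Any.index p)) g∈ ≢g)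
                            (Any.lookup-index p) x∈)
  two : ∀ i → ∃[ a ] ∃[ b ] (a ∈ X × b ∈ X) × a ≢ b × χ a ≡ i × χ b ≡ i
  two i =
    let g∈ = ∈-lookup {xs = L} i
        (a , b , (a∈ , b∈) , a≢b , _) = pair-elements (2≤L g∈) (L≤2 g∈)
        g⊆X = proj₁ (proj₂ (L∈ g∈))
    in a , b , (g⊆X a∈ , g⊆X b∈) , a≢b , lookup-injective uL (lookup-χ g∈ a∈) , lookup-injective uL (lookup-χ g∈ b∈)
  three : ∀ i → ∃[ a ] ∃[ b ] ∃[ c ] ∀ {x} → x ∈ X → χ x ≡ i → x List.∈ a ∷ b ∷ c ∷ []
  three i =
    let g∈ = ∈-lookup {xs = L} i
        (a , b , _ , _ , only) = pair-elements (2≤L g∈) (L≤2 g∈)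
    in a , b , b , λ x∈X χx≡i → pick (only (class x∈X χx≡i))
    where
    class : ∀ {x i} → x ∈ X → χ x ≡ i → x ∈ lookup L i
    class {x} x∈X refl = let (g , g∈ , x∈g) = List.find (covered x∈X) in subst (x ∈_) (sym (lookup-χ g∈ x∈g)) x∈g
    pick : ∀ {x a b : Fin n} → x ≡ a ⊎ x ≡ b → x List.∈ a ∷ b ∷ b ∷ []
    pick (inj₁ e) = here e
    pick (inj₂ e) = there (here e)
  mono⇒∈ : ∀ {f} → f ⊆ X → 2 ≤ ∣ f ∣ → Monochromatic χ f → f List.∈ G
  mono⇒∈ {f} f⊆X 2≤ mono =
    let (x , x∈f) = 0<∣p∣⇒nonempty f (≤-trans (s≤s z≤n) 2≤)
        (g , g∈ , x∈g) = List.find (covered (f⊆X x∈f))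
        f⊆g = λ {y} (y∈f : y ∈ f) → let (h , h∈ , y∈h) = List.find (covered (f⊆X y∈f)) in
          subst (y ∈_) (trans (sym (lookup-χ h∈ y∈h)) (trans (cong (lookup L) (mono y∈f x∈f)) (lookup-χ g∈ x∈g))) y∈h
    in subst (List._∈ G) (sym (⊆∧∣∣≤⇒≡ (λ {y} → f⊆g {y}) (≤-trans (L≤2 g∈) 2≤))) (proj₁ (L∈ g∈))

-- Putting back a vertex of degree three

other-two : ∀ {g : A} {xs} → length xs ≡ 3 → g List.∈ xs →
  ∃[ h ] ∃[ h′ ] h List.∈ xs × h′ List.∈ xs × (∀ {f} → f List.∈ xs → f ≡ g ⊎ f ≡ h ⊎ f ≡ h′)
other-two {xs = a ∷ b ∷ c ∷ []} refl (here refl) = b , c , there (here refl) , there (there (here refl)) , λ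
  { (here e) → inj₁ e ; (there (here e)) → inj₂ (inj₁ e) ; (there (there (here e))) → inj₂ (inj₂ e) }
other-two {xs = a ∷ b ∷ c ∷ []} refl (there (here refl)) = a , c , here refl , there (there (here refl)) , λ
  { (here e) → inj₂ (inj₁ e) ; (there (here e)) → inj₁ e ; (there (there (here e))) → inj₂ (inj₂ e) }
other-two {xs = a ∷ b ∷ c ∷ []} refl (there (there (here refl))) = a , b , here refl , there (here refl) , λ
  { (here e) → inj₂ (inj₁ e) ; (there (here e)) → inj₂ (inj₂ e) ; (there (there (here e))) → inj₁ e }

-- If every part met S outside g, these points would need k further members of
-- the cover of S: a member disjoint from g avoids z and so lies in one part.
abstract
  absorbed-part : ∀ {G : List (Subset n)} {X z S} → DisjointlyCoverable G X k → (c : Colouring G (X - z) k) →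
    let open Colouring c in S ⊆ X → z ∈ S →
    ∃[ g ] g List.∈ G × z ∈ g × g ⊆ S × ∃[ i ] (∀ {x} → x ∈ S → x ≢ z → χ x ≡ i → x ∈ g)
  absorbed-part {n = n} {k} {G = G} {X} {z} {S} D c S⊆X z∈S = finish (Fin.all? escape?)
    where
    open Colouring c
    cov : Cover G k S
    cov = proj₁ (D S S⊆X)
    g : Subset n
    g = proj₁ (onto cov z∈S)
    g∈ : g List.∈ parts cov
    g∈ = proj₁ (proj₂ (onto cov z∈S))
    z∈g : z ∈ g
    z∈g = proj₂ (proj₂ (onto cov z∈S))
    Escapes : Fin k → Fin n → Set
    Escapes i x = x ∈ S × x ≢ z × χ x ≡ i × x ∉ g
    escape? : ∀ i → Dec (∃[ x ] Escapes i x)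
    escape? i = Fin.any? λ x → (x ∈? S) ×-dec ¬? (x Fin.≟ z) ×-dec (χ x Fin.≟ i) ×-dec ¬? (x ∈? g)
    too-many : ¬ (∀ i → ∃[ x ] Escapes i x)
    too-many esc = <⇒≱ (s≤s (few cov)) (Fin.injective⇒≤ {f = f} f-injective)
      where
      h : Fin k → Subset n
      h i = proj₁ (onto cov (proj₁ (proj₂ (esc i))))
      h∈ : ∀ i → h i List.∈ parts cov
      h∈ i = proj₁ (proj₂ (onto cov (proj₁ (proj₂ (esc i)))))
      x∈h : ∀ i → proj₁ (esc i) ∈ h i
      x∈h i = proj₂ (proj₂ (onto cov (proj₁ (proj₂ (esc i)))))
      h≢g : ∀ i → h i ≢ g
      h≢g i e = proj₂ (proj₂ (proj₂ (proj₂ (esc i)))) (subst (proj₁ (esc i) ∈_) e (x∈h i))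
      z∉h : ∀ i → z ∉ h i
      z∉h i z∈h = disjoint-∉ (AllPairs-lookup disjoint-sym (proj₂ (D S S⊆X)) (h∈ i) g∈ (h≢g i)) z∈h z∈g
      χ-esc : ∀ i → χ (proj₁ (esc i)) ≡ i
      χ-esc i = proj₁ (proj₂ (proj₂ (proj₂ (esc i))))
      h-injective : ∀ {i j} → h i ≡ h j → i ≡ j
      h-injective {i} {j} e with i Fin.≟ j
      ... | yes i≡j = i≡j
      ... | no  i≢j = trans (sym (χ-esc i)) (trans (∈⇒mono
          (from cov (h∈ i) , (λ y∈ → x∈p∧x≢y⇒x∈p-y (S⊆X (within cov (h∈ i) y∈)) λ { refl → z∉h i y∈ })
          , two-elements⇒2≤ (x∈h i) xj∈ λ e′ → i≢j (trans (sym (χ-esc i)) (trans (cong χ e′) (χ-esc j))))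
          (x∈h i) xj∈) (χ-esc j))
        where
        xj∈ : proj₁ (esc j) ∈ h i
        xj∈ = subst (proj₁ (esc j) ∈_) (sym e) (x∈h j)
      f : Fin (suc k) → Fin (length (parts cov))
      f zero    = Any.index g∈
      f (suc i) = Any.index (h∈ i)
      f-injective : ∀ {i j} → f i ≡ f j → i ≡ j
      f-injective {zero}  {zero}  e = refl
      f-injective {zero}  {suc j} e = ⊥-elim (h≢g j (sym (index-injective g∈ (h∈ j) e)))
      f-injective {suc i} {zero}  e = ⊥-elim (h≢g i (index-injective (h∈ i) g∈ e))
      f-injective {suc i} {suc j} e = cong suc (h-injective (index-injective (h∈ i) (h∈ j) e))
    finish : Dec (∀ i → ∃[ x ] Escapes i x) →
      ∃[ g ] g List.∈ G × z ∈ g × g ⊆ S × ∃[ i ] (∀ {x} → x ∈ S → x ≢ z → χ x ≡ i → x ∈ g)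
    finish (yes esc) = ⊥-elim (too-many esc)
    finish (no ¬esc) =
      let (i , ¬e) = Fin.¬∀⟶∃¬ k (λ i → ∃[ x ] Escapes i x) escape? ¬esc
      in g , from cov g∈ , z∈g , within cov g∈ , i , λ {x} x∈S x≢z χx → absorbed i ¬e x (x ∈? g) x∈S x≢z χx
      where
      absorbed : ∀ i → ¬ (∃[ x ] Escapes i x) → ∀ x → Dec (x ∈ g) → x ∈ S → x ≢ z → χ x ≡ i → x ∈ g
      absorbed i ¬e x (yes x∈g) _ _ _ = x∈g
      absorbed i ¬e x (no  x∉g) x∈S x≢z χx = ⊥-elim (¬e (x , x∈S , x≢z , χx , x∉g))

_∈ᴸ?_ : ∀ (x : Fin n) xs → Dec (x List.∈ xs)
x ∈ᴸ? xs = Any.any? (x Fin.≟_) xs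

module _ {G : List (Subset n)} {X : Subset n} {z : Fin n} (z∈X : z ∈ X) (D : DisjointlyCoverable G X k)
  (col : Colouring G (X - z) k) where

  open Colouring col
  open Balanced balanced

  PartIn : Fin k → List (Fin n) → Set
  PartIn i xs = ∀ {x} → x ∈ X → x ≢ z → χ x ≡ i → x List.∈ xs

  ∈-⇒≢ : ∀ {x} → x ∈ X - z → x ≢ z
  ∈-⇒≢ x∈ refl = x∉p-x X z x∈

  ∈star : ∀ {g x} → g List.∈ G → g ⊆ X → z ∈ g → x ∈ g → x ≢ z → g List.∈ star G X z
  ∈star g∈ g⊆ z∈g x∈g x≢z = ∈-filter⁺ (z ∈?_)
    (∈-filter⁺ (Edge? X) g∈ ((λ {x} → g⊆ {x}) , two-elements⇒2≤ x∈g z∈g x≢z)) z∈g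

  star-edge : ∀ {g} → g List.∈ star G X z → (g List.∈ G × g ⊆ X × 2 ≤ ∣ g ∣) × z ∈ g
  star-edge p = let (q , z∈) = ∈-filter⁻ (z ∈?_) {xs = edges G X} p
                in ∈-filter⁻ (Edge? X) {xs = G} q , z∈

  ⊆X : ∀ {g x} → g List.∈ star G X z → x ∈ g → x ∈ X
  ⊆X p = proj₁ (proj₂ (proj₁ (star-edge p)))

  other-element : ∀ {g} → g List.∈ star G X z → ∃[ x ] x ∈ g × x ≢ z
  other-element {g} p = let (x , x∈ , x∉) = larger⇒∃ g (z ∷ []) (proj₂ (proj₂ (proj₁ (star-edge p))))
                        in x , x∈ , x∉ ∘ here

  -- Apply `absorbed-part` to `X` itself. The absorbed part is nonempty, so `g` has a second point
  -- and is an edge.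
  whole-part : ∃[ g ] g List.∈ star G X z × ∃[ i ] ∀ {x} → x ∈ X → x ≢ z → χ x ≡ i → x ∈ g
  whole-part with absorbed-part D col id z∈X
  ... | g , g∈ , z∈g , g⊆ , i , absorb with two-of i
  ...   | a , _ , (a∈ , _) , _ , χa , _ =
    g , ∈star g∈ g⊆ z∈g (absorb (p-x⊆p X z a∈) (∈-⇒≢ a∈) χa) (∈-⇒≢ a∈) , i , absorb

  module ThreeEdges {g₁ g₂ g₃ : Subset n} (g₁∈star : g₁ List.∈ star G X z) (g₂∈star : g₂ List.∈ star G X z)
    (g₃∈star : g₃ List.∈ star G X z) (star⊆ : ∀ {f} → f List.∈ star G X z → f ≡ g₁ ⊎ f ≡ g₂ ⊎ f ≡ g₃)
    {i₀ : Fin k} (part⊆g₁ : ∀ {x} → x ∈ X → x ≢ z → χ x ≡ i₀ → x ∈ g₁) where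

    -- X ∖ (a ∷ b ∷ c ∷ []) contains no edge through z, so it misses a part.
    blocked : ∀ {a b c} → a ∈ g₁ → b ∈ g₂ → c ∈ g₃ → a ≢ z → b ≢ z → c ≢ z →
      ∃[ i ] PartIn i (a ∷ b ∷ c ∷ [])
    blocked {a} {b} {c} a∈ b∈ c∈ a≢ b≢ c≢ =
      missed (absorbed-part {S = X ∖ abc} D col (∖-⊆ abc) (∈-∖⁺ abc z∈X z∉abc))
      where
      abc = a ∷ b ∷ c ∷ []
      z∉abc : ¬ z List.∈ abc
      z∉abc (here e) = a≢ (sym e)
      z∉abc (there (here e)) = b≢ (sym e)
      z∉abc (there (there (here e))) = c≢ (sym e)
      missed : (∃[ g ] g List.∈ G × z ∈ g × g ⊆ X ∖ abc ×
                 ∃[ i ] (∀ {x} → x ∈ X ∖ abc → x ≢ z → χ x ≡ i → x ∈ g)) → ∃[ i ] PartIn i abc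
      missed (g , g∈ , z∈g , g⊆ , i , absorb) = i , inside-abc
        where
        absurd : ¬ (g ≡ g₁ ⊎ g ≡ g₂ ⊎ g ≡ g₃)
        absurd (inj₁ e)        = ∈-∖⁻ abc (g⊆ (subst (a ∈_) (sym e) a∈)) (here refl)
        absurd (inj₂ (inj₁ e)) = ∈-∖⁻ abc (g⊆ (subst (b ∈_) (sym e) b∈)) (there (here refl))
        absurd (inj₂ (inj₂ e)) = ∈-∖⁻ abc (g⊆ (subst (c ∈_) (sym e) c∈)) (there (there (here refl)))
        inside-abc : PartIn i abc
        inside-abc {x} x∈X x≢z χx with x ∈ᴸ? abc
        ... | yes p = p
        ... | no ¬p = ⊥-elim (absurd (star⊆ (∈star g∈ (λ q → ∖-⊆ abc (g⊆ q)) z∈g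
                (absorb (∈-∖⁺ abc x∈X ¬p) x≢z χx) x≢z)))

    drop-head : ∀ {i a b c} → χ a ≢ i → PartIn i (a ∷ b ∷ c ∷ []) → PartIn i (b ∷ c ∷ [])
    drop-head χa≢ p x∈ x≢ χx with p x∈ x≢ χx
    ... | here refl = ⊥-elim (χa≢ χx)
    ... | there q = q

    -- Part `i₀` supplies two choices of the point removed from `g₁`. If a blocked part differs from
    -- `i₀`, that point is not in it and can be struck from the list. If both blocked parts are
    -- `i₀`, it lies in both lists, whose common points are `b` and `c`.
    part-pair : ∀ {b c} → b ∈ g₂ → c ∈ g₃ → b ≢ z → c ≢ z → ∃[ i ] PartIn i (b ∷ c ∷ [])
    part-pair {b} {c} b∈ c∈ b≢ c≢ =
      let (a , a′ , (a∈ , a′∈) , a≢a′ , χa , χa′) = two-of i₀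
          (i , p) = blocked (part⊆g₁ (p-x⊆p X z a∈) (∈-⇒≢ a∈) χa) b∈ c∈ (∈-⇒≢ a∈) b≢ c≢
          (j , q) = blocked (part⊆g₁ (p-x⊆p X z a′∈) (∈-⇒≢ a′∈) χa′) b∈ c∈ (∈-⇒≢ a′∈) b≢ c≢
      in pick i j a≢a′ χa χa′ p q
      where
      meet : ∀ {x a a′} → a ≢ a′ → x List.∈ a ∷ b ∷ c ∷ [] → x List.∈ a′ ∷ b ∷ c ∷ [] → x List.∈ b ∷ c ∷ []
      meet a≢a′ (here refl) (here e)  = ⊥-elim (a≢a′ e)
      meet a≢a′ (here refl) (there q) = q
      meet a≢a′ (there p)   _         = p
      pick : ∀ i j {a a′} → a ≢ a′ → χ a ≡ i₀ → χ a′ ≡ i₀ →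
             PartIn i (a ∷ b ∷ c ∷ []) → PartIn j (a′ ∷ b ∷ c ∷ []) → ∃[ m ] PartIn m (b ∷ c ∷ [])
      pick i j a≢a′ χa χa′ p q with i Fin.≟ i₀ | j Fin.≟ i₀
      ... | no i≢ | _ = i , drop-head (λ e → i≢ (trans (sym e) χa)) p
      ... | yes _ | no j≢ = j , drop-head (λ e → j≢ (trans (sym e) χa′)) q
      ... | yes refl | yes refl = i₀ , λ x∈ x≢ χx → meet a≢a′ (p x∈ x≢ χx) (q x∈ x≢ χx)

    -- Every part has at least two points, so a part contained in the list `b`, `c` consists of
    -- exactly these, and they differ.
    part-pair′ : ∀ {b c} → b ∈ g₂ → c ∈ g₃ → b ≢ z → c ≢ z →
      ∃[ m ] χ b ≡ m × χ c ≡ m × b ≢ c × PartIn m (b ∷ c ∷ [])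
    part-pair′ b∈ c∈ b≢ c≢ =
      let (m , p) = part-pair b∈ c∈ b≢ c≢
          (x , y , (x∈ , y∈) , x≢y , χx , χy) = two-of m
          (χb , χc , b≢c) = settle x≢y χx χy (p (p-x⊆p X z x∈) (∈-⇒≢ x∈) χx) (p (p-x⊆p X z y∈) (∈-⇒≢ y∈) χy)
      in m , χb , χc , b≢c , p
      where
      settle : ∀ {m x y b c} → x ≢ y → χ x ≡ m → χ y ≡ m → x List.∈ b ∷ c ∷ [] → y List.∈ b ∷ c ∷ [] →
               χ b ≡ m × χ c ≡ m × b ≢ c
      settle x≢y χx χy (here refl) (here refl) = ⊥-elim (x≢y refl)
      settle x≢y χx χy (here refl) (there (here refl)) = χx , χy , x≢y
      settle x≢y χx χy (there (here refl)) (here refl) = χy , χx , x≢y ∘ sym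
      settle x≢y χx χy (there (here refl)) (there (here refl)) = ⊥-elim (x≢y refl)

    module Pair {b d : Fin n} {m : Fin k} (b∈g₂ : b ∈ g₂) (b≢z : b ≢ z) (d∈g₃ : d ∈ g₃) (d≢z : d ≢ z)
      (χb : χ b ≡ m) (χd : χ d ≡ m) (b≢d : b ≢ d) (part-m : PartIn m (b ∷ d ∷ [])) where

      -- With `d` fixed, any other choice of `x` in `g₂` again forms a part with `d`. It must be the
      -- part of `b` and `d`, whence `x` is `b`. The argument for `g₃` is symmetric.
      g₂-only : ∀ {x} → x ∈ g₂ → x ≢ z → x ≡ b
      g₂-only x∈ x≢z with part-pair′ x∈ d∈g₃ x≢z d≢z
      ... | m′ , χx , χd′ , x≢d , _ with part-m (⊆X g₂∈star x∈) x≢z (trans χx (trans (sym χd′) χd))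
      ...   | here e = e
      ...   | there (here e) = ⊥-elim (x≢d e)

      g₃-only : ∀ {x} → x ∈ g₃ → x ≢ z → x ≡ d
      g₃-only x∈ x≢z with part-pair′ b∈g₂ x∈ b≢z x≢z
      ... | m′ , χb′ , χx , b≢x , _ with part-m (⊆X g₃∈star x∈) x≢z (trans χx (trans (sym χb′) χb))
      ...   | here e = ⊥-elim (b≢x (sym e))
      ...   | there (here e) = e

      -- Suppose `e` had another colour and remove only `e`. This excludes `g₁`, so the edge
      -- absorbing a part is `g₂` or `g₃`. Besides `z` it contains only `b` or only `d`, so it
      -- absorbs the part of colour `m`; but that part still contains both.
      g₁⊆part : ∀ {e} → e ∈ g₁ → e ≢ z → χ e ≡ m
      g₁⊆part {e} e∈ e≢z with χ e Fin.≟ m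
      ... | yes p = p
      ... | no χe≢m = ⊥-elim (impossible (absorbed-part {S = X ∖ (e ∷ [])} D col (∖-⊆ (e ∷ [])) (∈-∖⁺ (e ∷ []) z∈X λ { (here p) → e≢z (sym p) })))
        where
        S = X ∖ (e ∷ [])
        b∈X = ⊆X g₂∈star b∈g₂
        d∈X = ⊆X g₃∈star d∈g₃
        ∈S : ∀ {x} → x ∈ X → x ≢ e → x ∈ S
        ∈S x∈ x≢e = ∈-∖⁺ (e ∷ []) x∈ λ { (here p) → x≢e p }
        -- Each part has two points, so one is left after `e` is removed; hence the absorbing member
        -- has a point besides `z` and is an edge.
        survivor : ∀ i → ∃[ x ] x ∈ S × x ≢ z × χ x ≡ i
        survivor i with two-of i
        ... | x , y , (x∈ , y∈) , x≢y , χx , χy with x Fin.≟ e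
        ...   | no x≢e = x , ∈S (p-x⊆p X z x∈) x≢e , ∈-⇒≢ x∈ , χx
        ...   | yes refl = y , ∈S (p-x⊆p X z y∈) (x≢y ∘ sym) , ∈-⇒≢ y∈ , χy
        impossible : ¬ (∃[ g ] g List.∈ G × z ∈ g × g ⊆ S × ∃[ i ] (∀ {x} → x ∈ S → x ≢ z → χ x ≡ i → x ∈ g))
        impossible (g , g∈ , z∈g , g⊆S , i , absorb) with survivor i
        ... | x , x∈S , x≢z , χx with star⊆ (∈star g∈ (λ q → ∖-⊆ (e ∷ []) (g⊆S q)) z∈g (absorb x∈S x≢z χx) x≢z)
        ...   | inj₁ refl = ∈-∖⁻ (e ∷ []) (g⊆S e∈) (here refl)
        ...   | inj₂ (inj₁ refl) with g₂-only (absorb x∈S x≢z χx) x≢z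
        ...     | refl = b≢d (sym (g₂-only (absorb (∈S d∈X λ { refl → χe≢m χd }) d≢z
                    (trans χd (trans (sym χb) χx))) d≢z))
        impossible (g , g∈ , z∈g , g⊆S , i , absorb)
            | x , x∈S , x≢z , χx | inj₂ (inj₂ refl) with g₃-only (absorb x∈S x≢z χx) x≢z
        ...     | refl = b≢d (g₃-only (absorb (∈S b∈X λ { refl → χe≢m χb }) b≢z
                    (trans χb (trans (sym χd) χx))) b≢z)

      i₀≡m : i₀ ≡ m
      i₀≡m = let (a , _ , (a∈ , _) , _ , χa , _) = two-of i₀
             in trans (sym χa) (g₁⊆part (part⊆g₁ (p-x⊆p X z a∈) (∈-⇒≢ a∈) χa) (∈-⇒≢ a∈))

      b∈g₁ : b ∈ g₁
      b∈g₁ = part⊆g₁ (⊆X g₂∈star b∈g₂) b≢z (trans χb (sym i₀≡m))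
      d∈g₁ : d ∈ g₁
      d∈g₁ = part⊆g₁ (⊆X g₃∈star d∈g₃) d≢z (trans χd (sym i₀≡m))

      χ′ : Fin n → Fin k
      χ′ x with x Fin.≟ z
      ... | yes _ = m
      ... | no  _ = χ x

      χ′-z : χ′ z ≡ m
      χ′-z with z Fin.≟ z
      ... | yes _ = refl
      ... | no ≢ = ⊥-elim (≢ refl)

      χ′-≢ : ∀ {x} → x ≢ z → χ′ x ≡ χ x
      χ′-≢ {x} x≢z with x Fin.≟ z
      ... | yes e = ⊥-elim (x≢z e)
      ... | no _ = refl

      star-mono : ∀ {g x} → g List.∈ star G X z → x ∈ g → χ′ x ≡ m
      star-mono {x = x} p x∈ with x Fin.≟ z
      ... | yes refl = refl
      ... | no x≢z with star⊆ p
      ...   | inj₁ refl = g₁⊆part x∈ x≢z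
      ...   | inj₂ (inj₁ refl) = trans (cong χ (g₂-only x∈ x≢z)) χb
      ...   | inj₂ (inj₂ refl) = trans (cong χ (g₃-only x∈ x≢z)) χd

      without-z : ∀ {f} → f ⊆ X → z ∉ f → f ⊆ X - z
      without-z f⊆ z∉ x∈ = x∈p∧x≢y⇒x∈p-y (f⊆ x∈) λ { refl → z∉ x∈ }

      member≢z : ∀ {f x} → z ∉ f → x ∈ f → x ≢ z
      member≢z z∉ x∈ refl = z∉ x∈

      -- The class of `b` and `d` grows to `z`, `b`, `d`. The three edges through `z` are `z` with
      -- `b`, with `d`, and with both: exactly the monochromatic sets of size at least two through
      -- `z`.
      insert-pair : Colouring G X k
      insert-pair = record
        { χ = χ′
        ; balanced = record { two-of = two ; three-of = three }
        ; mono⇒∈ = mono′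
        ; ∈⇒mono = ∈⇒mono′
        }
        where
        two : ∀ i → ∃[ x ] ∃[ y ] (x ∈ X × y ∈ X) × x ≢ y × χ′ x ≡ i × χ′ y ≡ i
        two i = let (x , y , (x∈ , y∈) , x≢y , χx , χy) = two-of i
                in x , y , (p-x⊆p X z x∈ , p-x⊆p X z y∈) , x≢y
                   , trans (χ′-≢ (∈-⇒≢ x∈)) χx , trans (χ′-≢ (∈-⇒≢ y∈)) χy
        three : ∀ i → ∃[ x ] ∃[ y ] ∃[ w ] ∀ {v} → v ∈ X → χ′ v ≡ i → v List.∈ x ∷ y ∷ w ∷ []
        three i with m Fin.≟ i
        ... | yes refl = z , b , d , λ {v} v∈ χv → in-m v v∈ χv
          where
          in-m : ∀ v → v ∈ X → χ′ v ≡ m → v List.∈ z ∷ b ∷ d ∷ []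
          in-m v v∈ χv with v Fin.≟ z
          ... | yes e = here e
          ... | no v≢z = there (part-m v∈ v≢z χv)
        ... | no m≢i = let (x , y , w , only) = three-of i in x , y , w , λ {v} v∈ χv →
                let v≢z = λ { refl → m≢i (trans (sym χ′-z) χv) }
                in only (x∈p∧x≢y⇒x∈p-y v∈ v≢z) (trans (sym (χ′-≢ v≢z)) χv)
        ∈⇒mono′ : ∀ {f} → Edge G X f → Monochromatic χ′ f
        ∈⇒mono′ {f} (f∈ , f⊆ , 2≤) x∈ y∈ with z ∈? f
        ... | no z∉ = trans (χ′-≢ (member≢z z∉ x∈)) (trans (∈⇒mono (f∈ , without-z f⊆ z∉ , 2≤) x∈ y∈)
                        (sym (χ′-≢ (member≢z z∉ y∈))))
        ... | yes z∈ = let p = ∈-filter⁺ (z ∈?_) (∈-filter⁺ (Edge? X) f∈ ((λ {x} → f⊆ {x}) , 2≤)) z∈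
                       in trans (star-mono p x∈) (sym (star-mono p y∈))
        mono′ : ∀ {f} → f ⊆ X → 2 ≤ ∣ f ∣ → Monochromatic χ′ f → f List.∈ G
        mono′ {f} f⊆ 2≤ mono with z ∈? f
        ... | no z∉ = mono⇒∈ (without-z f⊆ z∉) 2≤ λ x∈ y∈ →
                trans (sym (χ′-≢ (member≢z z∉ x∈))) (trans (mono x∈ y∈) (χ′-≢ (member≢z z∉ y∈)))
        -- A monochromatic `f` through `z` is determined by which of `b` and `d` it contains: both
        -- give `g₁`, one gives `g₂` or `g₃`, and neither would leave only `z`.
        ... | yes z∈ = choose (b ∈? f) (d ∈? f)
          where
          in-bd : ∀ {x} → x ∈ f → x ≢ z → x List.∈ b ∷ d ∷ []
          in-bd x∈ x≢z = part-m (f⊆ x∈) x≢z (trans (sym (χ′-≢ x≢z)) (trans (mono x∈ z∈) χ′-z))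
          equal : ∀ {g} → g List.∈ star G X z → (∀ {x} → x ∈ f → x ≢ z → x ∈ g) →
                  (∀ {x} → x ∈ g → x ≢ z → x ∈ f) → f List.∈ G
          equal {g} p to back = subst (List._∈ G) (⊆-antisym g⊆f f⊆g) (proj₁ (proj₁ (star-edge p)))
            where
            f⊆g : f ⊆ g
            f⊆g {x} x∈ with x Fin.≟ z
            ... | yes refl = proj₂ (star-edge p)
            ... | no x≢z = to x∈ x≢z
            g⊆f : g ⊆ f
            g⊆f {x} x∈ with x Fin.≟ z
            ... | yes refl = z∈
            ... | no x≢z = back x∈ x≢z
          choose : Dec (b ∈ f) → Dec (d ∈ f) → f List.∈ G
          choose (yes b∈) (yes d∈) = equal g₁∈star to back
            where
            to : ∀ {x} → x ∈ f → x ≢ z → x ∈ g₁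
            to x∈ x≢z with in-bd x∈ x≢z
            ... | here refl = b∈g₁
            ... | there (here refl) = d∈g₁
            back : ∀ {x} → x ∈ g₁ → x ≢ z → x ∈ f
            back x∈ x≢z with part-m (⊆X g₁∈star x∈) x≢z (g₁⊆part x∈ x≢z)
            ... | here refl = b∈
            ... | there (here refl) = d∈
          choose (yes b∈) (no d∉) = equal g₂∈star to λ x∈ x≢z → subst (_∈ f) (sym (g₂-only x∈ x≢z)) b∈
            where
            to : ∀ {x} → x ∈ f → x ≢ z → x ∈ g₂
            to x∈ x≢z with in-bd x∈ x≢z
            ... | here refl = b∈g₂
            ... | there (here refl) = ⊥-elim (d∉ x∈)
          choose (no b∉) (yes d∈) = equal g₃∈star to λ x∈ x≢z → subst (_∈ f) (sym (g₃-only x∈ x≢z)) d∈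
            where
            to : ∀ {x} → x ∈ f → x ≢ z → x ∈ g₃
            to x∈ x≢z with in-bd x∈ x≢z
            ... | here refl = ⊥-elim (b∉ x∈)
            ... | there (here refl) = d∈g₃
          choose (no b∉) (no d∉) = let (x , x∈ , x∉) = larger⇒∃ f (z ∷ []) 2≤ in ⊥-elim (neither x∈ (x∉ ∘ here))
            where
            neither : ∀ {x} → x ∈ f → ¬ x ≢ z
            neither x∈ x≢z with in-bd x∈ x≢z
            ... | here refl = b∉ x∈
            ... | there (here refl) = d∉ x∈

    insert : Colouring G X k
    insert with other-element g₂∈star | other-element g₃∈star
    ... | b , b∈ , b≢z | d , d∈ , d≢z with part-pair′ b∈ d∈ b≢z d≢z
    ...   | m , χb , χd , b≢d , part-m = Pair.insert-pair b∈ b≢z d∈ d≢z χb χd b≢d part-m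

  insert : length (star G X z) ≡ 3 → Colouring G X k
  insert deg with whole-part
  ... | g₁ , g₁∈ , i₀ , part⊆g₁ with other-two deg g₁∈
  ...   | g₂ , g₃ , g₂∈ , g₃∈ , star⊆ = ThreeEdges.insert g₁∈ g₂∈ g₃∈ star⊆ part⊆g₁

-- The case of equality

-- Induction on the excess of `∣ X ∣` over `2 * k`. At excess 0 tightness leaves exactly `k` edges,
-- a perfect matching. Otherwise tightness, set against the lower bound for `X - z`, forces `z` to
-- have degree exactly three and makes `X - z` tight too.
tight⇒colouring : ∀ {G : List (Subset n)} → Unique G → Fin k → ∀ m X → ∣ X ∣ ≡ m + 2 * k →
  DisjointlyCoverable G X k → length (edges G X) + 5 * k ≤ 3 * ∣ X ∣ → Colouring G X k
tight⇒colouring {k = k} {G = G} u i₀ zero X size≡ D tight = build k i₀ (≤-antisym k≤ ≤k) (λ S S⊆ → proj₁ (D S S⊆)) size≡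
  where
  open ≤-Reasoning
  l = length (edges G X)
  C : Coverable G X k
  C S S⊆ = proj₁ (D S S⊆)
  k≤ : k ≤ l
  k≤ = let (ds , len , hit) = representatives (edges G X) (edge-nonempty G X) in +-cancelʳ-≤ k k l (begin
    k + k          ≡⟨ solve₁ k ⟩
    2 * k          ≡⟨ size≡ ⟨
    ∣ X ∣          ≤⟨ edge-hitting-bound C ds hit ⟩
    length ds + k  ≡⟨ cong (_+ k) len ⟩
    l + k          ∎)
    where
    solve₁ : ∀ k → k + k ≡ 2 * k
    solve₁ = solve-∀
  ≤k : l ≤ k
  ≤k = +-cancelʳ-≤ (5 * k) l k (begin
    l + 5 * k    ≤⟨ tight ⟩
    3 * ∣ X ∣    ≡⟨ cong (3 *_) size≡ ⟩
    3 * (2 * k)  ≡⟨ solve₂ k ⟩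
    k + 5 * k    ∎)
    where
    solve₂ : ∀ k → 3 * (2 * k) ≡ k + 5 * k
    solve₂ = solve-∀
  -- Generalising over `k` allows it to be replaced by the number of edges.
  build : ∀ k → Fin k → k ≡ length (edges G X) → Coverable G X k → ∣ X ∣ ≡ 2 * k → Colouring G X k
  build k i₀ refl C size≡ = matching-colouring i₀ u C size≡
tight⇒colouring {n = n} {k} {G} u i₀ (suc m) X size≡ D tight = insert z∈X D
  (tight⇒colouring u i₀ m (X - z) (suc-injective (trans (sym (∣p-x∣+1 z∈X)) size≡)) D′ tight′)
  (≤-antisym star≤3 3≤)
  where
  open ≤-Reasoning
  C : Coverable G X k
  C S S⊆ = proj₁ (D S S⊆)
  hd = high-degree C (subst (2 * k <_) (sym size≡) (s≤s (m≤n+m (2 * k) m)))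
  z = proj₁ hd
  z∈X : z ∈ X
  z∈X = proj₁ (proj₂ hd)
  3≤ : 3 ≤ length (star G X z)
  3≤ = proj₂ (proj₂ hd)
  D′ : DisjointlyCoverable G (X - z) k
  D′ S S⊆ = D S (λ q → p-x⊆p X z (S⊆ q))
  s = length (star G X z)
  l′ = length (edges G (X - z))
  total : s + (l′ + 5 * k) ≤ 3 + 3 * ∣ X - z ∣
  total = begin
    s + (l′ + 5 * k)               ≡⟨ solve₁ s l′ (5 * k) ⟩
    l′ + s + 5 * k                 ≤⟨ +-monoˡ-≤ (5 * k) (edges-delete X z u) ⟩
    length (edges G X) + 5 * k     ≤⟨ tight ⟩
    3 * ∣ X ∣                      ≡⟨ cong (3 *_) (∣p-x∣+1 z∈X) ⟩
    3 * suc ∣ X - z ∣              ≡⟨ *-suc 3 ∣ X - z ∣ ⟩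
    3 + 3 * ∣ X - z ∣              ∎
    where
    solve₁ : ∀ a b c → a + (b + c) ≡ b + a + c
    solve₁ = solve-∀
  tight′ : l′ + 5 * k ≤ 3 * ∣ X - z ∣
  tight′ = +-cancelˡ-≤ 3 _ _ (≤-trans (+-monoˡ-≤ _ 3≤) total)
  star≤3 : s ≤ 3
  star≤3 = +-cancelʳ-≤ (3 * ∣ X - z ∣) s 3 (≤-trans (+-monoʳ-≤ s (edges-lower-bound u n (X - z) (∣p∣≤n (X - z))
    (λ S S⊆ → proj₁ (D′ S S⊆)))) total)

-- Counting parts and their subsets

module _ (f : A → ℕ) where

  count : ℕ → List A → ℕ
  count m xs = length (filter (λ x → f x ≟ m) xs)

  count-accept : ∀ {m x} xs → f x ≡ m → count m (x ∷ xs) ≡ suc (count m xs)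
  count-accept {m} xs e = cong length (filter-accept (λ x → f x ≟ m) {xs = xs} e)

  count-reject : ∀ {m x} xs → f x ≢ m → count m (x ∷ xs) ≡ count m xs
  count-reject {m} xs e = cong length (filter-reject (λ x → f x ≟ m) {xs = xs} e)

  TwoOrThree : A → Set
  TwoOrThree x = f x ≡ 2 ⊎ f x ≡ 3

  -- Used with weight 1 for the number of parts, the identity for their total size, and `atLeast j`
  -- for the number of their subsets.
  sum-two-or-three : ∀ (w : ℕ → ℕ) xs → All TwoOrThree xs →
    sum (map (λ x → w (f x)) xs) ≡ count 2 xs * w 2 + count 3 xs * w 3
  sum-two-or-three w [] [] = refl
  sum-two-or-three w (x ∷ xs) (inj₁ e ∷ ps)
    rewrite e | sum-two-or-three w xs ps = sym (+-assoc (w 2) _ _)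
  sum-two-or-three w (x ∷ xs) (inj₂ e ∷ ps)
    rewrite e | sum-two-or-three w xs ps = rearrange (w 3) (count 2 xs * w 2) (count 3 xs * w 3)
    where
    rearrange : ∀ a b c → a + (b + c) ≡ b + (a + c)
    rearrange = solve-∀

  count-step≤ : ∀ x xs → count 2 (x ∷ xs) + count 3 (x ∷ xs) ≤ suc (count 2 xs + count 3 xs)
  count-step≤ x xs with f x ≟ 2 | f x ≟ 3
  ... | yes e | yes e′ = contradiction (trans (sym e) e′) λ ()
  ... | yes e | no e′ rewrite count-accept xs e | count-reject {3} xs e′ = ≤-refl
  ... | no e | yes e′ rewrite count-reject {2} xs e | count-accept xs e′ = ≤-reflexive (+-suc _ _)
  ... | no e | no e′ rewrite count-reject {2} xs e | count-reject {3} xs e′ = n≤1+n _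

  count≤length : ∀ xs → count 2 xs + count 3 xs ≤ length xs
  count≤length [] = z≤n
  count≤length (x ∷ xs) = ≤-trans (count-step≤ x xs) (s≤s (count≤length xs))

  -- A balanced partition records only how many parts have each of the two sizes; since these
  -- numbers add up to the number of parts, no other size occurs.
  count≡length⇒TwoOrThree : ∀ xs → length xs ≤ count 2 xs + count 3 xs → All TwoOrThree xs
  count≡length⇒TwoOrThree [] _ = []
  count≡length⇒TwoOrThree (x ∷ xs) le with f x ≟ 2 | f x ≟ 3
  ... | yes e | _ = inj₁ e ∷ count≡length⇒TwoOrThree xs (ℕ.s≤s⁻¹ (≤-trans le (count-step≤ x xs)))
  ... | no _ | yes e = inj₂ e ∷ count≡length⇒TwoOrThree xs (ℕ.s≤s⁻¹ (≤-trans le (count-step≤ x xs)))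
  ... | no e | no e′ rewrite count-reject {2} xs e | count-reject {3} xs e′ = ⊥-elim (<⇒≱ le (count≤length xs))

-- The number of subsets with at least `j` elements of a set of `m` elements, by Pascal's recursion.
atLeast : ℕ → ℕ → ℕ
atLeast zero    zero    = 1
atLeast (suc j) zero    = 0
atLeast zero    (suc m) = atLeast 0 m + atLeast 0 m
atLeast (suc j) (suc m) = atLeast (suc j) m + atLeast j m

-- The subsets of `V` with at least `j` elements, listed along the recursion of `atLeast`.
subsetsOf : ℕ → Subset n → List (Subset n)
subsetsOf zero    []            = [] ∷ []
subsetsOf (suc j) []            = []
subsetsOf j       (outside ∷ V) = map (outside ∷_) (subsetsOf j V)
subsetsOf zero    (inside ∷ V)  = map (outside ∷_) (subsetsOf zero V) ++ map (inside ∷_) (subsetsOf zero V)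
subsetsOf (suc j) (inside ∷ V)  = map (outside ∷_) (subsetsOf (suc j) V) ++ map (inside ∷_) (subsetsOf j V)

length-subsetsOf : ∀ j (V : Subset n) → length (subsetsOf j V) ≡ atLeast j ∣ V ∣
length-subsetsOf zero    []            = refl
length-subsetsOf (suc j) []            = refl
length-subsetsOf zero    (outside ∷ V) = trans (length-map _ (subsetsOf 0 V)) (length-subsetsOf 0 V)
length-subsetsOf (suc j) (outside ∷ V) = trans (length-map _ (subsetsOf (suc j) V)) (length-subsetsOf (suc j) V)
length-subsetsOf zero    (inside ∷ V)  = trans (length-++ (map _ (subsetsOf 0 V)))
  (cong₂ _+_ (trans (length-map _ (subsetsOf 0 V)) (length-subsetsOf 0 V))
             (trans (length-map _ (subsetsOf 0 V)) (length-subsetsOf 0 V)))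
length-subsetsOf (suc j) (inside ∷ V)  = trans (length-++ (map _ (subsetsOf (suc j) V)))
  (cong₂ _+_ (trans (length-map _ (subsetsOf (suc j) V)) (length-subsetsOf (suc j) V))
             (trans (length-map _ (subsetsOf j V)) (length-subsetsOf j V)))

∈-subsetsOf : ∀ j (V s : Subset n) → s ⊆ V → j ≤ ∣ s ∣ → s List.∈ subsetsOf j V
∈-subsetsOf zero    []            []            _ _ = here refl
∈-subsetsOf zero    (outside ∷ V) (outside ∷ s) p q = ∈-map⁺ _ (∈-subsetsOf 0 V s (drop-∷-⊆ p) z≤n)
∈-subsetsOf (suc j) (outside ∷ V) (outside ∷ s) p q = ∈-map⁺ _ (∈-subsetsOf (suc j) V s (drop-∷-⊆ p) q)
∈-subsetsOf j       (outside ∷ V) (inside ∷ s)  p q with () ← p here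
∈-subsetsOf zero    (inside ∷ V)  (outside ∷ s) p q =
  ∈-++⁺ˡ (∈-map⁺ _ (∈-subsetsOf 0 V s (drop-∷-⊆ p) z≤n))
∈-subsetsOf zero    (inside ∷ V)  (inside ∷ s)  p q =
  ∈-++⁺ʳ (map _ (subsetsOf 0 V)) (∈-map⁺ _ (∈-subsetsOf 0 V s (drop-∷-⊆ p) z≤n))
∈-subsetsOf (suc j) (inside ∷ V)  (outside ∷ s) p q =
  ∈-++⁺ˡ (∈-map⁺ _ (∈-subsetsOf (suc j) V s (drop-∷-⊆ p) q))
∈-subsetsOf (suc j) (inside ∷ V)  (inside ∷ s)  p q =
  ∈-++⁺ʳ (map _ (subsetsOf (suc j) V)) (∈-map⁺ _ (∈-subsetsOf j V s (drop-∷-⊆ p) (ℕ.s≤s⁻¹ q)))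

∈-subsets : ∀ (s : Subset n) → s List.∈ subsets n
∈-subsets []            = here refl
∈-subsets (outside ∷ s) = ∈-++⁺ˡ (∈-map⁺ _ (∈-subsets s))
∈-subsets {suc n} (inside ∷ s) = ∈-++⁺ʳ (map (outside ∷_) (subsets n)) (∈-map⁺ _ (∈-subsets s))

length-concatMap : ∀ {B : Set} (f : A → List B) xs → length (concatMap f xs) ≡ sum (map (length ∘ f) xs)
length-concatMap f []       = refl
length-concatMap f (x ∷ xs) = trans (length-++ (f x)) (cong (length (f x) +_) (length-concatMap f xs))

-- Balanced partitions and the construction

fibre : (Fin n → Fin k) → Fin k → Subset n
fibre χ i = Vec.tabulate λ x → does (χ x Fin.≟ i)

∈-fibre⁺ : ∀ (χ : Fin n → Fin k) {x} → x ∈ fibre χ (χ x)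
∈-fibre⁺ χ {x} = Vec.lookup⇒[]= x _ (trans (Vec.lookup∘tabulate _ x) (dec-true (χ x Fin.≟ χ x) refl))

∈-fibre⁻ : ∀ (χ : Fin n → Fin k) {x i} → x ∈ fibre χ i → χ x ≡ i
∈-fibre⁻ χ {x} {i} x∈ with χ x Fin.≟ i | trans (sym (Vec.lookup∘tabulate (λ x → does (χ x Fin.≟ i)) x)) (Vec.[]=⇒lookup x∈)
... | yes e | _ = e
... | no _  | ()

fibres-disjoint : ∀ (χ : Fin n → Fin k) {i j} → i ≢ j → Disjoint (fibre χ i) (fibre χ j)
fibres-disjoint χ {i} {j} i≢j (x , x∈) = let (p , q) = x∈p∩q⁻ (fibre χ i) (fibre χ j) x∈
                                          in i≢j (trans (sym (∈-fibre⁻ χ p)) (∈-fibre⁻ χ q))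

⌈n/k⌉≡3 : ∀ n k .{{_ : NonZero k}} → 2 * k < n → n ≤ 3 * k → ⌈ n / k ⌉ ≡ 3
⌈n/k⌉≡3 n k@(suc k′) lo hi = ≤-antisym (ℕ.s≤s⁻¹ (m<n*o⇒m/o<n {n = 4} upper)) lower
  where
  open ≤-Reasoning
  upper : n + k′ < 4 * k
  upper = begin-strict
    n + k′     ≤⟨ +-monoˡ-≤ k′ hi ⟩
    3 * k + k′ <⟨ +-monoʳ-< (3 * k) (n<1+n k′) ⟩
    3 * k + k  ≡⟨ +-comm (3 * k) k ⟩
    4 * k      ∎
  lower : 3 ≤ (n + k′) / k
  lower = begin
    3               ≡⟨ m*n/n≡m 3 k ⟨
    3 * k / k       ≤⟨ /-monoˡ-≤ k (begin
      3 * k           ≡⟨ rearrange k′ ⟩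
      suc (2 * k) + k′ ≤⟨ +-monoˡ-≤ k′ lo ⟩
      n + k′          ∎) ⟩
    (n + k′) / k    ∎
    where
    rearrange : ∀ k′ → 3 * suc k′ ≡ suc (2 * suc k′) + k′
    rearrange = solve-∀

-- With t parts of size 3 and r of size 2.
module _ (t r : ℕ) .{{_ : NonZero (t + r)}} (0<t : 0 < t) where

  private
    K N : ℕ
    K = t + r
    N = t + 2 * (t + r)

    3K≡ : 3 * K ≡ N + r
    3K≡ = rearrange t r
      where
      rearrange : ∀ t r → 3 * (t + r) ≡ t + 2 * (t + r) + r
      rearrange = solve-∀

    ceil : ⌈ N / K ⌉ ≡ 3
    ceil = ⌈n/k⌉≡3 N K (m<n+m (2 * K) 0<t) (≤-trans (m≤m+n N r) (≤-reflexive (sym 3K≡)))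

    deficit≡ : deficit N K ≡ r
    deficit≡ = trans (cong (λ p → p * K ∸ N) ceil) (trans (cong (_∸ N) 3K≡) (m+n∸m≡n N r))

    K∸deficit≡ : K ∸ deficit N K ≡ t
    K∸deficit≡ = trans (cong (K ∸_) deficit≡) (m+n∸n≡m t r)

  -- The value `4 * N - 5 * K` of the bound `size≥1`, written without subtraction.
  constr+5K : constr N K + 5 * K ≡ 4 * N
  constr+5K rewrite deficit≡ | ceil | m+n∸n≡m t r = rearrange t r
    where
    rearrange : ∀ t r → r * 3 + t * 7 + 5 * (t + r) ≡ 4 * (t + 2 * (t + r))
    rearrange = solve-∀

  -- All classes have size 2 or 3, so their numbers `a` and `b` are determined by `a + b = K` and
  -- `2 * a + 3 * b = N`.
  partition : (χ : Fin N → Fin K) → Balanced ⊤ χ → BalancedPartition N K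
  partition χ bal = record
    { part     = V
    ; disjoint = fibres-disjoint χ
    ; covering = λ x → χ x , ∈-fibre⁺ χ
    ; small    = trans (cong (λ p → partsOfSize (p ∸ 1) V) ceil) (trans twos (sym deficit≡))
    ; large    = trans (cong (λ p → partsOfSize p V) ceil) (trans threes (sym K∸deficit≡))
    }
    where
    open Balanced bal
    V : Fin K → Subset N
    V = fibre χ
    2≤V : ∀ i → 2 ≤ ∣ V i ∣
    2≤V i with two-of i
    ... | a , b , _ , a≢b , refl , χb = two-elements⇒2≤ (∈-fibre⁺ χ) (subst (λ j → b ∈ V j) χb (∈-fibre⁺ χ)) a≢b
    V≤3 : ∀ i → ∣ V i ∣ ≤ 3
    V≤3 i = let (_ , _ , _ , only) = three-of i in ∣p∣≤length (V i) _ (λ x∈ → only ∈⊤ (∈-fibre⁻ χ x∈))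
    two-or-three : ∀ {m} → 2 ≤ m → m ≤ 3 → m ≡ 2 ⊎ m ≡ 3
    two-or-three (s≤s (s≤s z≤n)) (s≤s (s≤s z≤n))       = inj₁ refl
    two-or-three (s≤s (s≤s z≤n)) (s≤s (s≤s (s≤s z≤n))) = inj₂ refl
    sizes : All (TwoOrThree (∣_∣ ∘ V)) (allFin K)
    sizes = All.tabulate λ {i} _ → two-or-three (2≤V i) (V≤3 i)
    a = partsOfSize 2 V
    b = partsOfSize 3 V
    number : a * 1 + b * 1 ≡ K
    number = trans (sym (sum-two-or-three (∣_∣ ∘ V) (λ _ → 1) (allFin K) sizes))
                   (trans (sum-ones (allFin K)) (length-tabulate {n = K} id))
      where
      sum-ones : ∀ {A : Set} (xs : List A) → sum (map (λ _ → 1) xs) ≡ length xs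
      sum-ones []       = refl
      sum-ones (_ ∷ xs) = cong suc (sum-ones xs)
    Vs = tabulate V
    total : a * 2 + b * 3 ≡ N
    total = trans (sym (sum-two-or-three (∣_∣ ∘ V) id (allFin K) sizes))
      (trans (cong sum (trans (map-tabulate id (∣_∣ ∘ V)) (sym (map-tabulate V ∣_∣)))) (≤-antisym
        (≤-trans (sum≤∣X∣ Vs {⊤} (AllPairs.tabulate⁺ (fibres-disjoint χ)) λ _ _ → ∈⊤) (∣p∣≤n ⊤))
        (≤-trans (≤-reflexive (sym (∣⊤∣≡n N)))
          (≤-trans (p⊆q⇒∣p∣≤∣q∣ {p = ⊤} {q = ⋃ Vs} λ {x} _ → ∈-⋃⁺ (∈-tabulate⁺ (χ x)) (∈-fibre⁺ χ)) (∣⋃∣≤sum Vs)))))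
    threes : b ≡ t
    threes = +-cancelʳ-≡ (2 * (t + r)) b t (trans (cong (λ m → b + 2 * m) (sym number)) (trans (rearrange a b) total))
      where
      rearrange : ∀ a b → b + 2 * (a * 1 + b * 1) ≡ a * 2 + b * 3
      rearrange = solve-∀
    twos : a ≡ r
    twos = +-cancelˡ-≡ t a r (trans (cong (_+ a) (sym threes)) (trans (rearrange a b) number))
      where
      rearrange : ∀ a b → b + a ≡ a * 1 + b * 1
      rearrange = solve-∀

  -- A concrete partition, witnessing that the minima are attained. The class of `i` contains `i`
  -- and `i + K`, both below `2 * K`, and also `i + 2 * K` when this is below `N`.
  residue : Fin N → Fin K
  residue x = toℕ x mod K

  residue-balanced : Balanced ⊤ residue
  residue-balanced = record { two-of = two ; three-of = three }
    where
    2K≤N : 2 * K ≤ N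
    2K≤N = m≤n+m (2 * K) t
    toℕ-residue : ∀ x → toℕ (residue x) ≡ toℕ x % K
    toℕ-residue x = Fin.toℕ-fromℕ< (m%n<n (toℕ x) K)
    at : ∀ q i → (q<2 : suc q ≤ 2) → toℕ {K} i + q * K < N
    at q i q<2 = <-≤-trans (+-monoˡ-< (q * K) (Fin.toℕ<n i)) (≤-trans (*-monoˡ-≤ K q<2) 2K≤N)
    residue-at : ∀ q i (lt : toℕ {K} i + q * K < N) → residue (fromℕ< lt) ≡ i
    residue-at q i lt = Fin.toℕ-injective (trans (toℕ-residue _) (trans (cong (_% K) (Fin.toℕ-fromℕ< lt))
      (trans ([m+kn]%n≡m%n (toℕ i) q K) (m<n⇒m%n≡m (Fin.toℕ<n i)))))
    place : ∀ {x} i q → residue x ≡ i → toℕ x / K ≡ q → toℕ x ≡ toℕ i + q * K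
    place {x} i q refl refl = trans (m≡m%n+[m/n]*n (toℕ x) K) (cong (_+ toℕ x / K * K) (sym (toℕ-residue x)))
    two : ∀ i → ∃[ a ] ∃[ b ] (a ∈ ⊤ × b ∈ ⊤) × a ≢ b × residue a ≡ i × residue b ≡ i
    two i = fromℕ< (at 0 i (s≤s z≤n)) , fromℕ< (at 1 i ≤-refl) , (∈⊤ , ∈⊤)
      , (λ e → m≢m+1*K (trans (sym (Fin.toℕ-fromℕ< _)) (trans (cong toℕ e) (Fin.toℕ-fromℕ< _))))
      , residue-at 0 i (at 0 i (s≤s z≤n)) , residue-at 1 i (at 1 i ≤-refl)
      where
      m≢m+1*K : toℕ i + 0 * K ≢ toℕ i + 1 * K
      m≢m+1*K e = <⇒≢ (≤-trans 0<t (m≤m+n t r)) (trans (+-cancelˡ-≡ (toℕ i) (0 * K) (1 * K) e) (*-identityˡ K))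
    -- The third place is a dummy when toℕ i + 2 * K is out of range.
    three : ∀ i → ∃[ a ] ∃[ b ] ∃[ c ] ∀ {x} → x ∈ ⊤ → residue x ≡ i → x List.∈ a ∷ b ∷ c ∷ []
    three i = a , b , c (toℕ i + 2 * K <? N) , λ {x} _ e → locate x e (toℕ x / K) refl (toℕ i + 2 * K <? N)
      where
      a b : Fin N
      a = fromℕ< (at 0 i (s≤s z≤n))
      b = fromℕ< (at 1 i ≤-refl)
      c : Dec (toℕ i + 2 * K < N) → Fin N
      c (yes lt) = fromℕ< lt
      c (no _)   = b
      same : ∀ {x m} (lt : m < N) → toℕ x ≡ m → x ≡ fromℕ< lt
      same lt e = Fin.toℕ-injective (trans e (sym (Fin.toℕ-fromℕ< lt)))
      locate : ∀ x → residue x ≡ i → ∀ q → toℕ x / K ≡ q → (d : Dec (toℕ i + 2 * K < N)) →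
               x List.∈ a ∷ b ∷ c d ∷ []
      locate x e 0 q≡ d = here (same (at 0 i (s≤s z≤n)) (place i 0 e q≡))
      locate x e 1 q≡ d = there (here (same (at 1 i ≤-refl) (place i 1 e q≡)))
      locate x e 2 q≡ (yes lt) = there (there (here (same lt (place i 2 e q≡))))
      locate x e 2 q≡ (no ≮) = ⊥-elim (≮ (subst (_< N) (place i 2 e q≡) (Fin.toℕ<n x)))
      locate x e (suc (suc (suc q))) q≡ d = ⊥-elim (<⇒≱
        (m<n*o⇒m/o<n {n = 3} (<-≤-trans (Fin.toℕ<n x) (≤-trans (m≤m+n N r) (≤-reflexive (sym 3K≡)))))
        (subst (3 ≤_) (sym q≡) (s≤s (s≤s (s≤s z≤n)))))

  module _ (π : BalancedPartition N K) where

    private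
      𝒞 = Constr N K π
      InPart? = λ (s : Subset N) → Fin.any? (λ i → s ⊆? part π i) ×-dec nonempty? s

    ∈-Constr⁺ : ∀ {s i} → s ⊆ part π i → Nonempty s → s List.∈ members 𝒞
    ∈-Constr⁺ {s} {i} s⊆ ne = ∈-filter⁺ InPart? (∈-subsets s) ((i , λ {x} → s⊆ {x}) , ne)

    ∈-Constr⁻ : ∀ {s} → s List.∈ members 𝒞 → (∃[ i ] s ⊆ part π i) × Nonempty s
    ∈-Constr⁻ s∈ = proj₂ (∈-filter⁻ InPart? {xs = subsets N} s∈)

    -- Each set occurs in the list `subsetsOf j` of some part; the lengths of these lists add up
    -- according to the `r` parts of size 2 and the `t` of size 3.
    length≤parts : ∀ j xs → Unique xs → (∀ {s} → s List.∈ xs → j ≤ ∣ s ∣ × ∃[ i ] s ⊆ part π i) →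
      length xs ≤ r * atLeast j 2 + t * atLeast j 3
    length≤parts j xs u within = begin
      length xs                                                    ≤⟨ unique-⊆⇒length≤ u sub ⟩
      length (concatMap (λ i → subsetsOf j (part π i)) (allFin K)) ≡⟨ length-concatMap _ (allFin K) ⟩
      sum (map (λ i → length (subsetsOf j (part π i))) (allFin K))
        ≡⟨ cong sum (map-cong (λ i → length-subsetsOf j (part π i)) (allFin K)) ⟩
      sum (map (λ i → atLeast j ∣ part π i ∣) (allFin K))
        ≡⟨ sum-two-or-three (∣_∣ ∘ part π) (atLeast j) (allFin K) sizes ⟩
      partsOfSize 2 (part π) * atLeast j 2 + partsOfSize 3 (part π) * atLeast j 3
        ≡⟨ cong₂ (λ a b → a * atLeast j 2 + b * atLeast j 3) twos threes ⟩
      r * atLeast j 2 + t * atLeast j 3                            ∎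
      where
      open ≤-Reasoning
      twos : partsOfSize 2 (part π) ≡ r
      twos = trans (cong (λ p → partsOfSize (p ∸ 1) (part π)) (sym ceil)) (trans (small π) deficit≡)
      threes : partsOfSize 3 (part π) ≡ t
      threes = trans (cong (λ p → partsOfSize p (part π)) (sym ceil)) (trans (large π) K∸deficit≡)
      sizes : All (TwoOrThree (∣_∣ ∘ part π)) (allFin K)
      sizes = count≡length⇒TwoOrThree (∣_∣ ∘ part π) (allFin K)
        (≤-reflexive (trans (length-tabulate {n = K} id) (trans (+-comm t r) (sym (cong₂ _+_ twos threes)))))
      sub : xs List.⊆ concatMap (λ i → subsetsOf j (part π i)) (allFin K)
      sub {s} s∈ = let (j≤ , i , s⊆) = within s∈ in
        ∈-concatMap⁺ _ (List.lose (∈-allFin i) (∈-subsetsOf j (part π i) s s⊆ j≤))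

    size-Constr≥ : ∀ j → size (𝒞 ≥∣ j ∣) ≤ r * atLeast j 2 + t * atLeast j 3
    size-Constr≥ j = length≤parts j _ (unique (𝒞 ≥∣ j ∣)) λ s∈ →
      let (p , j≤) = ∈-filter⁻ (λ g → j ≤? ∣ g ∣) {xs = members 𝒞} s∈ in j≤ , proj₁ (∈-Constr⁻ p)

    size-Constr+5K : size 𝒞 + 5 * K ≤ 4 * N
    size-Constr+5K = ≤-trans (+-monoˡ-≤ (5 * K) (length≤parts 1 _ (unique 𝒞) λ s∈ →
      let (p , _ , x∈) = ∈-Constr⁻ s∈ in nonempty⇒0<∣p∣ x∈ , p)) (≤-reflexive (rearrange t r))
      where
      rearrange : ∀ t r → r * 3 + t * 7 + 5 * (t + r) ≡ 4 * (t + 2 * (t + r))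
      rearrange = solve-∀

    Constr-generator : Generator N K 𝒞
    Constr-generator s _ = family ℋ (disjoint⇒unique ℋ pairwise nonempties) , ⊑𝒞 , few′ , pairwise , union
      where
      traces = tabulate (λ i → s ∩ part π i)
      -- Empty traces are not members of the construction and could repeat; the nonempty ones are
      -- disjoint and hence distinct.
      ℋ = filter nonempty? traces
      pairwise : AllPairs Disjoint ℋ
      pairwise = AllPairs.filter⁺ nonempty? (AllPairs.tabulate⁺ λ {i} {j} i≢j (x , x∈) →
        let (p , q) = x∈p∩q⁻ (s ∩ part π i) (s ∩ part π j) x∈
        in disjoint-∉ (disjoint π i≢j) (p∩q⊆q s (part π i) p) (p∩q⊆q s (part π j) q))
      nonempties : ∀ {h} → h List.∈ ℋ → Nonempty h
      nonempties h∈ = proj₂ (∈-filter⁻ nonempty? {xs = traces} h∈)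
      disjoint⇒unique : ∀ hs → AllPairs Disjoint hs → (∀ {h} → h List.∈ hs → Nonempty h) → Unique hs
      disjoint⇒unique [] _ _ = []
      disjoint⇒unique (h ∷ hs) (d ∷ ds) ne =
        All.tabulate (λ { p refl → let (x , x∈) = ne (here refl) in disjoint-∉ (All.lookup d p) x∈ x∈ })
        ∷ disjoint⇒unique hs ds (ne ∘ there)
      trace : ∀ {h} → h List.∈ ℋ → ∃[ i ] h ≡ s ∩ part π i
      trace h∈ = ∈-tabulate⁻ (proj₁ (∈-filter⁻ nonempty? {xs = traces} h∈))
      ⊑𝒞 : ℋ List.⊆ members 𝒞
      ⊑𝒞 h∈ with trace h∈
      ... | i , refl = ∈-Constr⁺ (p∩q⊆q s (part π i)) (nonempties h∈)
      few′ : length ℋ ≤ K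
      few′ = ≤-trans (length-filter nonempty? traces) (≤-reflexive (length-tabulate _))
      union : ⋃ ℋ ≡ s
      union = ⊆-antisym ⋃⊆ ⊆⋃
        where
        ⋃⊆ : ⋃ ℋ ⊆ s
        ⋃⊆ x∈ with ∈-⋃⁻ ℋ x∈
        ... | h , h∈ , x∈h with trace h∈
        ...   | i , refl = p∩q⊆p s (part π i) x∈h
        ⊆⋃ : s ⊆ ⋃ ℋ
        ⊆⋃ {x} x∈s = let (i , x∈) = covering π x ; q = x∈p∩q⁺ (x∈s , x∈) in
          ∈-⋃⁺ (∈-filter⁺ nonempty? (∈-tabulate⁺ i) (x , q)) q

-- From generators to the theorem

union⇒cover : ∀ (𝒢 : Family n) {S} → IsUnion k 𝒢 S → Cover (members 𝒢) k S
union⇒cover 𝒢 (ℋ , ⊑ , few , eq) = record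
  { parts = members ℋ ; from = ⊑ ; few = few
  ; within = λ h∈ x∈ → subst (_ ∈_) eq (∈-⋃⁺ h∈ x∈)
  ; onto = λ x∈ → ∈-⋃⁻ (members ℋ) (subst (_ ∈_) (sym eq) x∈) }

empty-cover : ∀ {G : List (Subset n)} {S} → ¬ Nonempty S → Cover G k S
empty-cover empty = record
  { parts = [] ; from = λ () ; few = z≤n ; within = λ () ; onto = λ x∈ → ⊥-elim (empty (_ , x∈)) }

weak-generator⇒coverable : ∀ {𝒢 : Family n} → WeakGenerator n k 𝒢 → Coverable (members 𝒢) ⊤ k
weak-generator⇒coverable {𝒢 = 𝒢} W S _ with nonempty? S
... | yes ne   = union⇒cover 𝒢 (W S ne)
... | no empty = empty-cover empty

generator⇒weak : ∀ {𝒢 : Family n} → Generator n k 𝒢 → WeakGenerator n k 𝒢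
generator⇒weak W S ne = let (ℋ , ⊑ , few , _ , eq) = W S ne in ℋ , ⊑ , few , eq

generator⇒coverable : ∀ {𝒢 : Family n} → Generator n k 𝒢 → DisjointlyCoverable (members 𝒢) ⊤ k
generator⇒coverable {𝒢 = 𝒢} W S _ with nonempty? S
... | no empty = empty-cover empty , []
... | yes ne with W S ne
...   | ℋ , ⊑ , few , pairwise , eq = union⇒cover 𝒢 (ℋ , ⊑ , few , eq) , pairwise

module _ (t r : ℕ) .{{_ : NonZero (t + r)}} (0<t : 0 < t) where

  private
    K N : ℕ
    K = t + r
    N = t + 2 * (t + r)

    Cov : ∀ (𝒢 : Family N) → Set
    Cov 𝒢 = Coverable (members 𝒢) ⊤ K

  constr≤size : ∀ (𝒢 : Family N) → WeakGenerator N K 𝒢 → constr N K ≤ size 𝒢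
  constr≤size 𝒢 W = +-cancelʳ-≤ (5 * K) _ _ (begin
    constr N K + 5 * K      ≡⟨ constr+5K t r 0<t ⟩
    4 * N                   ≤⟨ size≥1 (unique 𝒢) (weak-generator⇒coverable {𝒢 = 𝒢} W) ⟩
    size (𝒢 ≥∣ 1 ∣) + 5 * K ≤⟨ +-monoˡ-≤ (5 * K) (length-filter _ (members 𝒢)) ⟩
    size 𝒢 + 5 * K          ∎)
    where open ≤-Reasoning

  -- Counting subsets of the parts gives the upper bound; the lower bound is the general one for
  -- generators, applied to `Constr` itself.
  size-Constr : ∀ π → size (Constr N K π) ≡ constr N K
  size-Constr π = ≤-antisym
    (+-cancelʳ-≤ (5 * K) _ _ (≤-trans (size-Constr+5K t r 0<t π) (≤-reflexive (sym (constr+5K t r 0<t)))))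
    (constr≤size (Constr N K π) (generator⇒weak {𝒢 = Constr N K π} (Constr-generator t r 0<t π)))

  Constr-optimal : ∀ π → Optimal N K (Constr N K π)
  Constr-optimal π = gen , (Constr N K π , gen , refl) , λ 𝒢 W →
    subst (_≤ size 𝒢) (sym (size-Constr π)) (constr≤size 𝒢 (generator⇒weak {𝒢 = 𝒢} W))
    where gen = Constr-generator t r 0<t π

  residues : BalancedPartition N K
  residues = partition t r 0<t (residue t r 0<t) (residue-balanced t r 0<t)

  op≡constr : IsOp N K (constr N K)
  op≡constr = (𝒞 , generator⇒weak {𝒢 = 𝒞} (Constr-generator t r 0<t residues) , size-Constr residues) , constr≤size
    where 𝒞 = Constr N K residues

  opt≡constr : IsOpt N K (constr N K)
  opt≡constr = (Constr N K residues , Constr-generator t r 0<t residues , size-Constr residues) ,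
    λ 𝒢 W → constr≤size 𝒢 (generator⇒weak {𝒢 = 𝒢} W)

  -- For `i` equal to 1, 2, 3 the count for `Constr` is at most `4 * N - 5 * K`, `3 * N - 5 * K` and
  -- `N - 2 * K`, the lower bounds for every generator.
  size≥Constr≥ : ∀ 𝒢 → Generator N K 𝒢 → ∀ i → 1 ≤ i → i ≤ 3 → ∀ π → size (𝒢 ≥∣ i ∣) ≥ size (Constr N K π ≥∣ i ∣)
  size≥Constr≥ 𝒢 W i 1≤i i≤3 π = ≤-trans (size-Constr≥ t r 0<t π i) (bound i 1≤i i≤3)
    where
    C : Cov 𝒢
    C = weak-generator⇒coverable {𝒢 = 𝒢} (generator⇒weak {𝒢 = 𝒢} W)
    bound : ∀ i → 1 ≤ i → i ≤ 3 → r * atLeast i 2 + t * atLeast i 3 ≤ size (𝒢 ≥∣ i ∣)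
    bound 1 _ _ = +-cancelʳ-≤ (5 * K) _ _ (≤-trans (≤-reflexive (rearrange t r)) (size≥1 (unique 𝒢) C))
      where
      rearrange : ∀ t r → r * 3 + t * 7 + 5 * (t + r) ≡ 4 * (t + 2 * (t + r))
      rearrange = solve-∀
    bound 2 _ _ = +-cancelʳ-≤ (5 * K) _ _ (≤-trans (≤-reflexive (rearrange t r)) (size≥2 (unique 𝒢) C))
      where
      rearrange : ∀ t r → r * 1 + t * 4 + 5 * (t + r) ≡ 3 * (t + 2 * (t + r))
      rearrange = solve-∀
    bound 3 _ _ = +-cancelʳ-≤ (K * 2) _ _ (≤-trans (≤-reflexive (rearrange t r)) (size≥3 (unique 𝒢) C))
      where
      rearrange : ∀ t r → r * 0 + t * 1 + (t + r) * 2 ≡ t + 2 * (t + r)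
      rearrange = solve-∀
    bound (suc (suc (suc (suc i)))) _ (s≤s (s≤s (s≤s ())))

  -- The colouring decides membership of sets of size at least two, coverability supplies the
  -- singletons, and the empty set is excluded by assumption.
  colouring⇒≈ : ∀ (𝒢 : Family N) → Cov 𝒢 → (∀ {s} → s List.∈ members 𝒢 → 0 < ∣ s ∣) →
    (col : Colouring (members 𝒢) ⊤ K) →
    𝒢 ≈ Constr N K (partition t r 0<t (Colouring.χ col) (Colouring.balanced col))
  colouring⇒≈ 𝒢 C no-empty col {s} = mk⇔ (to s) (back s)
    where
    open Colouring col
    G = members 𝒢
    π : BalancedPartition N K
    π = partition t r 0<t χ balanced
    monochromatic : ∀ {s} → s List.∈ G → Monochromatic χ s
    monochromatic {s} s∈ {x} {y} x∈ y∈ with x Fin.≟ y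
    ... | yes refl = refl
    ... | no  x≢y  = ∈⇒mono (s∈ , (λ _ → ∈⊤) , two-elements⇒2≤ x∈ y∈ x≢y) x∈ y∈
    to : ∀ s → s List.∈ G → s List.∈ members (Constr N K π)
    to s s∈ = let (x , x∈) = 0<∣p∣⇒nonempty s (no-empty s∈) in
      ∈-Constr⁺ t r 0<t π (λ {y} y∈ → subst (λ i → y ∈ fibre χ i) (monochromatic s∈ y∈ x∈) (∈-fibre⁺ χ)) (x , x∈)
    back : ∀ s → s List.∈ members (Constr N K π) → s List.∈ G
    back s s∈ with ∈-Constr⁻ t r 0<t π s∈ | 2 ≤? ∣ s ∣
    ... | (i , s⊆) , x , x∈ | yes 2≤ = mono⇒∈ (λ _ → ∈⊤) 2≤ λ y∈ z∈ →
            trans (∈-fibre⁻ χ (s⊆ y∈)) (sym (∈-fibre⁻ χ (s⊆ z∈)))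
    ... | _ , x , x∈ | no ≱2 = subst (List._∈ G) (sym (⊆⁅x⁆⇒≡ x∈ λ {y} y∈ → in-singleton y∈ (y Fin.≟ x)))
            (singleton∈ C ∈⊤)
      where
      in-singleton : ∀ {y} → y ∈ s → Dec (y ≡ x) → y ∈ ⁅ x ⁆
      in-singleton y∈ (yes refl) = x∈⁅x⁆ x
      in-singleton y∈ (no y≢x)   = ⊥-elim (≱2 (two-elements⇒2≤ y∈ x∈ y≢x))

  -- Comparison with the residue construction bounds the size by `4 * N - 5 * K`. Taking away the
  -- `N` singletons leaves at most `3 * N - 5 * K` edges, which is the tight case.
  optimal⇒Constr : ∀ 𝒢 → Optimal N K 𝒢 → ∃[ π ] 𝒢 ≈ Constr N K π
  optimal⇒Constr 𝒢 (W , _ , minimal) =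
    partition t r 0<t (Colouring.χ col) (Colouring.balanced col) , colouring⇒≈ 𝒢 C no-empty col
    where
    open ≤-Reasoning
    G = members 𝒢
    u = unique 𝒢
    C : Cov 𝒢
    C = weak-generator⇒coverable {𝒢 = 𝒢} (generator⇒weak {𝒢 = 𝒢} W)
    e = length (edges G ⊤)
    size≤ : size 𝒢 + 5 * K ≤ N + 3 * N
    size≤ = ≤-trans (+-monoˡ-≤ (5 * K) (minimal (Constr N K residues) (Constr-generator t r 0<t residues)))
                    (size-Constr+5K t r 0<t residues)
    tight : e + 5 * K ≤ 3 * ∣ ⊤ {N} ∣
    tight = +-cancelˡ-≤ N _ _ (begin
      N + (e + 5 * K)  ≡⟨ +-assoc N e (5 * K) ⟨
      N + e + 5 * K    ≡⟨ cong (_+ 5 * K) (length-singletons∪edges u C) ⟨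
      length (singletons N ++ edges G ⊤) + 5 * K
        ≤⟨ +-monoˡ-≤ (5 * K) (unique-⊆⇒length≤ (singletons∪edges-unique u C) (λ p → proj₁ (singletons∪edges-⊆ u C p))) ⟩
      size 𝒢 + 5 * K   ≤⟨ size≤ ⟩
      N + 3 * N        ≡⟨ cong (λ m → N + 3 * m) (∣⊤∣≡n N) ⟨
      N + 3 * ∣ ⊤ {N} ∣ ∎)
    no-empty : ∀ {s} → s List.∈ G → 0 < ∣ s ∣
    no-empty {s} s∈ with 0 <? ∣ s ∣
    ... | yes lt = lt
    -- An empty member would come on top of the singletons and edges, exceeding the optimal size by
    -- one.
    ... | no ≮ = ⊥-elim (<⇒≱ (≤-trans more size≤) (+-monoʳ-≤ N (edges-lower-bound-⊤ u C)))
      where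
      more : suc (N + (e + 5 * K)) ≤ size 𝒢 + 5 * K
      more = begin
        suc (N + (e + 5 * K))  ≡⟨ cong suc (+-assoc N e (5 * K)) ⟨
        suc (N + e) + 5 * K    ≡⟨ cong (λ m → suc m + 5 * K) (length-singletons∪edges u C) ⟨
        suc (length (singletons N ++ edges G ⊤)) + 5 * K
          ≤⟨ +-monoˡ-≤ (5 * K) (unique-⊆⇒length≤
               (All.tabulate (λ { p refl → ≮ (proj₂ (singletons∪edges-⊆ u C p)) }) ∷ singletons∪edges-unique u C)
               (λ { (here refl) → s∈ ; (there p) → proj₁ (singletons∪edges-⊆ u C p) })) ⟩
        size 𝒢 + 5 * K         ∎
    col : Colouring G ⊤ K
    col = tight⇒colouring u (fromℕ< {0} (≤-trans 0<t (m≤m+n t r))) t ⊤ (∣⊤∣≡n N)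
            (generator⇒coverable {𝒢 = 𝒢} W) tight

-- Here `t = n - 2 * k` counts the parts of size 3 and `r = 3 * k - n` is the deficit; in terms of
-- `t` and `r` the arithmetic is free of subtraction.
decompose : ∀ {n k} → 2 * k < n → n ≤ 3 * k →
  ∃[ t ] ∃[ r ] 0 < t × k ≡ t + r × n ≡ t + 2 * (t + r)
decompose {n} {k} lo hi with m≤n⇒∃[o]m+o≡n lo
... | t′ , refl with m≤n⇒∃[o]m+o≡n {suc t′} {k} (+-cancelˡ-≤ (2 * k) (suc t′) k
      (≤-trans (≤-reflexive (+-suc (2 * k) t′)) (≤-trans hi (≤-reflexive (+-comm k (2 * k))))))
... | r , refl = suc t′ , r , s≤s z≤n , refl , rearrange t′ (2 * k)
  where
  rearrange : ∀ t′ m → suc m + t′ ≡ suc t′ + m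
  rearrange = solve-∀

theorem4 : ∀ (n k : ℕ) .{{_ : NonZero n}} .{{_ : NonZero k}} →
    2 * k < n → n ≤ 3 * k →
    (IsOp n k (constr n k) × IsOpt n k (constr n k))
    × (∀ 𝒢 → Generator n k 𝒢 → ∀ i → 1 ≤ i → i ≤ 3 →
    ∀ (π : BalancedPartition n k) →
    size (𝒢 ≥∣ i ∣) ≥ size (Constr n k π ≥∣ i ∣))
    × (∀ 𝒢 → Generator n k 𝒢 →
    ∃[ z ] degree z 𝒢 ≥ 2 ^ (⌈ n / k ⌉ ∸ 1))
    × ((∀ (π : BalancedPartition n k) → Optimal n k (Constr n k π))
    × (∀ 𝒢 → Optimal n k 𝒢 →
    ∃[ π ] 𝒢 ≈ Constr n k π))
theorem4 n k lo hi with decompose {n} {k} lo hi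
... | t , r , 0<t , refl , refl =
  (op≡constr t r 0<t , opt≡constr t r 0<t)
  , size≥Constr≥ t r 0<t
  , (λ 𝒢 W → subst (λ p → ∃[ z ] degree z 𝒢 ≥ 2 ^ (p ∸ 1)) (sym (⌈n/k⌉≡3 n k lo hi))
      (large-degree (unique 𝒢) (weak-generator⇒coverable {𝒢 = 𝒢} (generator⇒weak {𝒢 = 𝒢} W)) lo))
  , Constr-optimal t r 0<t
  , optimal⇒Constr t r 0<t
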